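{- Let $k\ge 2$ and $n$ be integers with $n>k^2$. Then $$m(n,k,1)=m(k^2,k,1)+\binom{k^2}{k}+\binom{k^2+1}{k}+\cdots+\binom{n-1}{k}.$$
   Context: For integers $n\ge k+1$, let $\mathcal V(n,k,1)\subset\mathbb R^n$ be the set of all vectors with coordinates in $\{0,1,-1\}$ having exactly $k$ coordinates equal to $+1$ and exactly one coordinate equal to $-1$ (all other coordinates $0$). For $n\ge 2k$ the minimum possible scalar product of two vectors in $\mathcal V(n,k,1)$ is $-2$. A family $\mathcal V\subset\mathcal V(n,k,1)$ is called intersecting if $\langle v,w\rangle>-2$ for all $v,w\in\mathcal V$. Let $m(n,k,1)$ be the maximum of $|\mathcal V|$ over all intersecting families $\mathcal V\subset\mathcal V(n,k,1)$. -}

module Defs where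

open import Data.Integer.Base as ℤ using (ℤ; 0ℤ; 1ℤ; -1ℤ)
import Data.Integer.Properties as ℤ
open import Data.List.Base using (List; []; _∷_; [_]; _++_; map; filter; length; cartesianProductWith)
open import Data.List.Extrema.Nat using (argmax; argmax-all; f[xs]≤f[argmax])
open import Data.List.Membership.Propositional using (_∈_)
open import Data.List.Membership.Propositional.Properties
  using (∈-++⁺ˡ; ∈-++⁺ʳ; ∈-map⁺; ∈-filter⁺; ∈-filter⁻; ∈-cartesianProductWith⁺)
open import Data.List.Membership.Propositional.Properties.WithK using (unique∧set⇒bag)
open import Data.List.Membership.DecPropositional ℤ._≟_ using (_∈?_)
open import Data.List.Relation.Binary.BagAndSetEquality using (∼bag⇒↭)
open import Data.List.Relation.Binary.Permutation.Propositional.Properties using (↭-length)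
open import Data.List.Relation.Unary.All as All using (All)
open import Data.List.Relation.Unary.All.Properties using (all-filter)
import Data.List.Relation.Unary.AllPairs as AllPairs
open import Data.List.Relation.Unary.Any using (here; there)
open import Data.List.Relation.Unary.Unique.Propositional using (Unique)
import Data.List.Relation.Unary.Unique.Propositional.Properties as Unique
open import Data.Nat.Base using (ℕ; zero; suc; _≤_)
import Data.Nat.Properties as ℕ
open import Data.Product.Base using (∃-syntax; _×_; _,_; proj₁; proj₂)
open import Data.Vec.Base as Vec using (Vec; []; _∷_; count)
import Data.Vec.Properties as Vec
import Data.Vec.Relation.Unary.All as VecAll
open import Function.Base using (_∘_)
open import Function.Bundles using (mk⇔)
open import Relation.Binary.Definitions using (DecidableEquality)
open import Relation.Binary.PropositionalEquality using (_≡_; refl; subst)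
open import Relation.Nullary.Decidable using (Dec; yes; no; ¬?; map′; _×-dec_)
open import Relation.Unary using (Pred; Decidable)

infix 4 _≟ᵛ_

⟨_,_⟩ : ∀ {n} → Vec ℤ n → Vec ℤ n → ℤ
⟨ v , w ⟩ = Vec.foldr′ ℤ._+_ 0ℤ (Vec.zipWith ℤ._*_ v w)

entries : List ℤ
entries = 0ℤ ∷ 1ℤ ∷ -1ℤ ∷ []

-- 𝒱 n k is 𝒱(n,k,1).
record 𝒱 (n k : ℕ) (v : Vec ℤ n) : Set where
  constructor mk𝒱
  field
    coordinates : VecAll.All (_∈ entries) v
    plus-ones   : count (ℤ._≟ 1ℤ) v ≡ k
    minus-ones  : count (ℤ._≟ -1ℤ) v ≡ 1

Intersecting : ∀ {n} → List (Vec ℤ n) → Set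
Intersecting F = ∀ v w → v ∈ F → w ∈ F → ⟨ v , w ⟩ ℤ.> ℤ.- (ℤ.+ 2)

-- Finite sets of vectors are duplicate-free lists, so cardinality is length.
record IntersectingFamily (n k : ℕ) (F : List (Vec ℤ n)) : Set where
  constructor mkFamily
  field
    unique       : Unique F
    members      : All (𝒱 n k) F
    intersecting : Intersecting F

Largest : ∀ {a p} {A : Set a} → Pred (List A) p → List A → Set _
Largest P F = P F × (∀ G → P G → length G ≤ length F)

_≟ᵛ_ : ∀ {n} → DecidableEquality (Vec ℤ n)
_≟ᵛ_ = Vec.≡-dec ℤ._≟_

𝒱? : ∀ n k → Decidable (𝒱 n k)
𝒱? n k v = map′ (λ (c , p , q) → mk𝒱 c p q) (λ (mk𝒱 c p q) → c , p , q)
  (VecAll.all? (_∈? entries) v ×-dec (count (ℤ._≟ 1ℤ) v ℕ.≟ k) ×-dec (count (ℤ._≟ -1ℤ) v ℕ.≟ 1))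

intersecting? : ∀ {n} (F : List (Vec ℤ n)) → Dec (Intersecting F)
intersecting? F = map′
  (λ h _ _ v∈F w∈F → All.lookup (All.lookup h v∈F) w∈F)
  (λ h → All.tabulate λ v∈F → All.tabulate λ w∈F → h _ _ v∈F w∈F)
  (All.all? (λ v → All.all? (λ w → ℤ.- (ℤ.+ 2) ℤ.<? ⟨ v , w ⟩) F) F)

intersectingFamily? : ∀ n k → Decidable (IntersectingFamily n k)
intersectingFamily? n k F = map′ (λ (u , m , i) → mkFamily u m i) (λ (mkFamily u m i) → u , m , i)
  (AllPairs.allPairs? (λ v w → ¬? (v ≟ᵛ w)) F ×-dec All.all? (𝒱? n k) F ×-dec intersecting? F)

cube : ∀ n → List (Vec ℤ n)
cube zero    = [ [] ]
cube (suc n) = cartesianProductWith _∷_ entries (cube n)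

cube-unique : ∀ n → Unique (cube n)
cube-unique zero    = All.[] AllPairs.∷ AllPairs.[]
cube-unique (suc n) = Unique.cartesianProductWith⁺ _∷_ Vec.∷-injective
  (((λ ()) All.∷ (λ ()) All.∷ All.[]) AllPairs.∷ ((λ ()) All.∷ All.[]) AllPairs.∷ All.[] AllPairs.∷ AllPairs.[])
  (cube-unique n)

∈-cube : ∀ {n} {v : Vec ℤ n} → VecAll.All (_∈ entries) v → v ∈ cube n
∈-cube VecAll.[]       = here refl
∈-cube (x VecAll.∷ xs) = ∈-cartesianProductWith⁺ _∷_ x (∈-cube xs)

sublists : ∀ {a} {A : Set a} → List A → List (List A)
sublists []       = [ [] ]
sublists (x ∷ xs) = map (x ∷_) (sublists xs) ++ sublists xs

filter∈sublists : ∀ {a p} {A : Set a} {P : Pred A p} (P? : Decidable P) xs →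
                  filter P? xs ∈ sublists xs
filter∈sublists P? [] = here refl
filter∈sublists P? (x ∷ xs) with P? x
... | yes _ = ∈-++⁺ˡ (∈-map⁺ (x ∷_) (filter∈sublists P? xs))
... | no  _ = ∈-++⁺ʳ (map (x ∷_) (sublists xs)) (filter∈sublists P? xs)

largestFamily : ∀ n k → ∃[ F ] Largest (IntersectingFamily n k) F
largestFamily n k = best , best-family , best-largest
  where
  open import Data.List.Membership.DecPropositional (_≟ᵛ_ {n}) using () renaming (_∈?_ to _∈ᵛ?_)

  candidates : List (List (Vec ℤ n))
  candidates = filter (intersectingFamily? n k) (sublists (cube n))

  best : List (Vec ℤ n)
  best = argmax length [] candidates

  best-family : IntersectingFamily n k best
  best-family = argmax-all length (mkFamily AllPairs.[] All.[] λ _ _ ())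
    (all-filter (intersectingFamily? n k) (sublists (cube n)))

  best-largest : ∀ G → IntersectingFamily n k G → length G ≤ length best
  best-largest G (mkFamily u m i) = subst (_≤ length best) (↭-length G′↭G)
    (All.lookup (f[xs]≤f[argmax] {f = length} [] candidates)
      (∈-filter⁺ (intersectingFamily? n k) (filter∈sublists (_∈ᵛ? G) (cube n)) G′-family))
    where
    G′ : List (Vec ℤ n)
    G′ = filter (_∈ᵛ? G) (cube n)

    G′⊆G : ∀ {v} → v ∈ G′ → v ∈ G
    G′⊆G = proj₂ ∘ ∈-filter⁻ (_∈ᵛ? G) {xs = cube n}

    G⊆G′ : ∀ {v} → v ∈ G → v ∈ G′
    G⊆G′ v∈G = ∈-filter⁺ (_∈ᵛ? G) (∈-cube (𝒱.coordinates (All.lookup m v∈G))) v∈G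

    G′-unique : Unique G′
    G′-unique = Unique.filter⁺ (_∈ᵛ? G) (cube-unique n)

    G′↭G = ∼bag⇒↭ (unique∧set⇒bag G′-unique u (mk⇔ G′⊆G G⊆G′))

    G′-family : IntersectingFamily n k G′
    G′-family = mkFamily G′-unique (All.tabulate (All.lookup m ∘ G′⊆G))
      (λ v w v∈G′ w∈G′ → i v w (G′⊆G v∈G′) (G′⊆G w∈G′))

-- m n k is m(n,k,1).
m : ℕ → ℕ → ℕ
m n k = length (proj₁ (largestFamily n k))

{-# OPTIONS --safe #-}

-- It suffices that m (n+1) = m n + C(n,k) for n ≥ k².  Treat the first coordinate as the new one.
-- Adding to an intersecting family of length n all vectors whose new coordinate is -1 gives ≥.
-- For ≤, exchange the new coordinate with every other one, moving the smaller value to the front,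
-- until the family is stable.  The vectors with new coordinate 0 number at most m n; let 𝒜 and ℬ
-- collect the remainders of those with new coordinate -1 and 1.  Choose at random k disjoint rows
-- of k coordinates, each consisting of a cell in a distinguished column and a block of k - 1 cells
-- (this needs n ≥ k²), and let c be the number of pairs (i , j) such that ℬ contains the vector
-- with +1 on block i and -1 on the column cell of row j.  If 𝒜 contains the indicator of the
-- column, then c = 0; otherwise stability forces all pairs counted by c onto one line of the k × k
-- grid, so c ≤ k.  Taking expectations gives |𝒜| + |ℬ| ≤ C(n,k).

module Submission where

open import Defs
open import Algebra.Properties.CommutativeSemigroup using (x∙yz≈y∙xz)
import Algebra.Properties.Semiring.Sum as Sum
open import Data.Bool.Base using (if_then_else_)
open import Data.Fin.Base using (Fin; zero; suc)
import Data.Fin.Properties as Fin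
open import Data.Integer.Base as ℤ using (ℤ; 0ℤ; 1ℤ; -1ℤ)
import Data.Integer.Properties as ℤ
import Data.Integer.Solver as ℤ
open import Data.List.Base using (List; []; _∷_; [_]; _++_; map; length; upTo)
open import Data.List.Membership.DecPropositional ℤ._≟_ using (_∈?_)
open import Data.List.Membership.Propositional using (_∈_; find; lose)
open import Data.List.Membership.Propositional.Properties using (∈-++⁻; ∈-map⁻)
open import Data.List.Properties using (length-map; length-++; map-++; map-∘; upTo-∷ʳ)
open import Data.List.Relation.Unary.All as All using (All)
import Data.List.Relation.Unary.All.Properties as All
import Data.List.Relation.Unary.AllPairs as AllPairs
open import Data.List.Relation.Unary.Any as Any using (here; there)
open import Data.List.Relation.Unary.Unique.Propositional using (Unique)
import Data.List.Relation.Unary.Unique.Propositional.Properties as Unique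
open import Data.Nat.Base
open import Data.Nat.Combinatorics using (_C_; nCk≡n!/k![n-k]!; k![n∸k]!∣n!; nCk+nC[k+1]≡[n+1]C[k+1])
open import Data.Nat.DivMod using (m/n*n≡m)
open import Data.Nat.ListAction using (sum)
open import Data.Nat.ListAction.Properties using (sum-++)
open import Data.Nat.Properties
open import Data.Nat.Solver using (module +-*-Solver)
open import Data.Product.Base using (∃-syntax; _×_; _,_; proj₁; proj₂)
open import Data.Sum.Base using (inj₁; inj₂)
open import Data.Vec.Base as Vec using (Vec; []; _∷_; count; lookup; removeAt; _[_]≔_)
open import Data.Vec.Properties using
  (∷-injectiveˡ; ∷-injectiveʳ; lookup∘update; lookup∘update′; lookup-map; []≔-idempotent; []≔-lookup)
import Data.Vec.Relation.Unary.All as VecAll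
open import Function.Base using (_∘_)
open import Relation.Binary.PropositionalEquality hiding ([_])
open import Relation.Nullary.Decidable using (Dec; yes; no; does; _×-dec_; ¬?; decidable-stable)
open import Relation.Nullary.Negation using (¬_; contradiction)
open import Relation.Unary using (Pred; Decidable)

open Sum +-*-semiring using (sum-syntax; sum-cong-≗; ∑-distrib-+; *-distribˡ-sum; *-distribʳ-sum)
  renaming (sum to ∑)
module _ {n : ℕ} where
  open import Data.List.Membership.DecPropositional (_≟ᵛ_ {n}) public using () renaming (_∈?_ to _∈ᵛ?_)

-- Indicators, finite sums and letter counts.

⟦_⟧ : ∀ {p} {P : Set p} → Dec P → ℕ
⟦ P? ⟧ = if does P? then 1 else 0

⟦⟧-no : ∀ {p} {P : Set p} (P? : Dec P) → ¬ P → ⟦ P? ⟧ ≡ 0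
⟦⟧-no (yes p) ¬p = contradiction p ¬p
⟦⟧-no (no _)  _  = refl

∑-mono : ∀ {n} {f g : Fin n → ℕ} → (∀ i → f i ≤ g i) → ∑ f ≤ ∑ g
∑-mono {zero}  f≤g = z≤n
∑-mono {suc n} f≤g = +-mono-≤ (f≤g zero) (∑-mono (f≤g ∘ suc))

∑-const : ∀ n c → ∑[ i < n ] c ≡ n * c
∑-const zero    c = refl
∑-const (suc n) c = cong (c +_) (∑-const n c)

∑-zero : ∀ {n} {f : Fin n → ℕ} → (∀ i → f i ≡ 0) → ∑ f ≡ 0
∑-zero {n} f≡0 = trans (sum-cong-≗ f≡0) (trans (∑-const n 0) (*-zeroʳ n))

∑-single : ∀ {n} {f : Fin n → ℕ} i → (∀ j → j ≢ i → f j ≡ 0) → ∑ f ≡ f i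
∑-single {f = f} zero    f≡0 = trans (cong (f zero +_) (∑-zero λ j → f≡0 (suc j) λ ())) (+-identityʳ _)
∑-single {f = f} (suc i) f≡0 = cong₂ _+_ (f≡0 zero λ ())
  (∑-single i λ j j≢i → f≡0 (suc j) (j≢i ∘ Fin.suc-injective))

count-∷ : ∀ {a p n} {A : Set a} {P : Pred A p} (P? : Decidable P) x (xs : Vec A n) →
          count P? (x ∷ xs) ≡ ⟦ P? x ⟧ + count P? xs
count-∷ P? x xs with P? x
... | yes _ = refl
... | no _  = refl

count-∑ : ∀ {a p n} {A : Set a} {P : Pred A p} (P? : Decidable P) (xs : Vec A n) →
          ∑[ i < n ] ⟦ P? (lookup xs i) ⟧ ≡ count P? xs
count-∑ P? []       = refl
count-∑ P? (x ∷ xs) = trans (cong (⟦ P? x ⟧ +_) (count-∑ P? xs)) (sym (count-∷ P? x xs))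

count-removeAt : ∀ {a p n} {A : Set a} {P : Pred A p} (P? : Decidable P) (xs : Vec A (suc n)) i →
                 count P? xs ≡ ⟦ P? (lookup xs i) ⟧ + count P? (removeAt xs i)
count-removeAt P? (x ∷ xs) zero = count-∷ P? x xs
count-removeAt P? (x ∷ xs@(_ ∷ _)) (suc i) = begin
  count P? (x ∷ xs)                         ≡⟨ count-∷ P? x xs ⟩
  ⟦ P? x ⟧ + count P? xs                    ≡⟨ cong (⟦ P? x ⟧ +_) (count-removeAt P? xs i) ⟩
  ⟦ P? x ⟧ + (b + c)                        ≡⟨ x∙yz≈y∙xz +-commutativeSemigroup ⟦ P? x ⟧ b c ⟩
  b + (⟦ P? x ⟧ + c)                        ≡⟨ cong (b +_) (count-∷ P? x (removeAt xs i)) ⟨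
  b + count P? (x ∷ removeAt xs i)          ∎
  where
  open ≡-Reasoning
  b = ⟦ P? (lookup xs i) ⟧
  c = count P? (removeAt xs i)

count-map : ∀ {a b p n} {A : Set a} {B : Set b} {P : Pred B p} (P? : Decidable P) (h : A → B) (xs : Vec A n) →
            count P? (Vec.map h xs) ≡ count (P? ∘ h) xs
count-map P? h []       = refl
count-map P? h (x ∷ xs) with P? (h x)
... | yes _ = cong suc (count-map P? h xs)
... | no _  = count-map P? h xs

count-++ : ∀ {a p m n} {A : Set a} {P : Pred A p} (P? : Decidable P) (xs : Vec A m) (ys : Vec A n) →
           count P? (xs Vec.++ ys) ≡ count P? xs + count P? ys
count-++ P? []       ys = refl
count-++ P? (x ∷ xs) ys with P? x
... | yes _ = cong suc (count-++ P? xs ys)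
... | no _  = count-++ P? xs ys

count-replicate : ∀ {a p} {A : Set a} {P : Pred A p} (P? : Decidable P) n x →
                  count P? (Vec.replicate n x) ≡ n * ⟦ P? x ⟧
count-replicate P? zero    x = refl
count-replicate P? (suc n) x = trans (count-∷ P? x (Vec.replicate n x)) (cong (⟦ P? x ⟧ +_) (count-replicate P? n x))

count-concat-tabulate : ∀ {a p m n} {A : Set a} {P : Pred A p} (P? : Decidable P) (f : Fin m → Vec A n) →
                        count P? (Vec.concat (Vec.tabulate f)) ≡ ∑[ i < m ] count P? (f i)
count-concat-tabulate {m = zero}  P? f = refl
count-concat-tabulate {m = suc m} P? f =
  trans (count-++ P? (f zero) _) (cong (count P? (f zero) +_) (count-concat-tabulate P? (f ∘ suc)))

-- Sums over all arrangements of a word.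

-- The sum of φ over all n! arrangements of xs, equal letters being distinguished.
∑ₐ : ∀ {X : Set} {n} → Vec X n → (Vec X n → ℕ) → ℕ
∑ₐ {n = zero}  xs φ = φ []
∑ₐ {n = suc n} xs φ = ∑[ i < suc n ] ∑ₐ (removeAt xs i) (λ w → φ (lookup xs i ∷ w))

∑ₐ-mono : ∀ {X : Set} {n} (xs : Vec X n) {φ ψ} → (∀ w → φ w ≤ ψ w) → ∑ₐ xs φ ≤ ∑ₐ xs ψ
∑ₐ-mono {n = zero}  xs φ≤ψ = φ≤ψ []
∑ₐ-mono {n = suc n} xs φ≤ψ = ∑-mono λ i → ∑ₐ-mono (removeAt xs i) λ w → φ≤ψ (lookup xs i ∷ w)

∑ₐ-cong : ∀ {X : Set} {n} (xs : Vec X n) {φ ψ} → (∀ w → φ w ≡ ψ w) → ∑ₐ xs φ ≡ ∑ₐ xs ψ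
∑ₐ-cong {n = zero}  xs φ≡ψ = φ≡ψ []
∑ₐ-cong {n = suc n} xs φ≡ψ = sum-cong-≗ λ i → ∑ₐ-cong (removeAt xs i) λ w → φ≡ψ (lookup xs i ∷ w)

∑ₐ-const : ∀ {X : Set} {n} (xs : Vec X n) c → ∑ₐ xs (λ _ → c) ≡ n ! * c
∑ₐ-const {n = zero}  xs c = sym (*-identityˡ c)
∑ₐ-const {n = suc n} xs c = begin
  ∑[ i < suc n ] ∑ₐ (removeAt xs i) (λ _ → c) ≡⟨ sum-cong-≗ (λ i → ∑ₐ-const (removeAt xs i) c) ⟩
  ∑[ i < suc n ] (n ! * c)                    ≡⟨ ∑-const (suc n) (n ! * c) ⟩
  suc n * (n ! * c)                           ≡⟨ *-assoc (suc n) (n !) c ⟨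
  suc n ! * c                                 ∎
  where open ≡-Reasoning

∑ₐ-zero : ∀ {X : Set} {n} (xs : Vec X n) {φ} → (∀ w → φ w ≡ 0) → ∑ₐ xs φ ≡ 0
∑ₐ-zero {n = n} xs φ≡0 = trans (∑ₐ-cong xs φ≡0) (trans (∑ₐ-const xs 0) (*-zeroʳ (n !)))

∑ₐ-+ : ∀ {X : Set} {n} (xs : Vec X n) φ ψ → ∑ₐ xs (λ w → φ w + ψ w) ≡ ∑ₐ xs φ + ∑ₐ xs ψ
∑ₐ-+ {n = zero}  xs φ ψ = refl
∑ₐ-+ {n = suc n} xs φ ψ = trans
  (sum-cong-≗ λ i → ∑ₐ-+ (removeAt xs i) (λ w → φ (lookup xs i ∷ w)) (λ w → ψ (lookup xs i ∷ w)))
  (∑-distrib-+ (λ i → ∑ₐ (removeAt xs i) λ w → φ (lookup xs i ∷ w))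
               (λ i → ∑ₐ (removeAt xs i) λ w → ψ (lookup xs i ∷ w)))

∑ₐ-* : ∀ {X : Set} {n} (xs : Vec X n) c φ → ∑ₐ xs (λ w → c * φ w) ≡ c * ∑ₐ xs φ
∑ₐ-* {n = zero}  xs c φ = refl
∑ₐ-* {n = suc n} xs c φ = trans
  (sum-cong-≗ λ i → ∑ₐ-* (removeAt xs i) c λ w → φ (lookup xs i ∷ w))
  (sym (*-distribˡ-sum c λ i → ∑ₐ (removeAt xs i) λ w → φ (lookup xs i ∷ w)))

∑ₐ-∑ : ∀ {X : Set} {m n} (xs : Vec X n) (φ : Fin m → Vec X n → ℕ) →
       ∑ₐ xs (λ w → ∑[ i < m ] φ i w) ≡ ∑[ i < m ] ∑ₐ xs (φ i)
∑ₐ-∑ {m = zero}  xs φ = ∑ₐ-zero xs λ _ → refl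
∑ₐ-∑ {m = suc m} xs φ = trans (∑ₐ-+ xs (φ zero) (λ w → ∑[ i < m ] φ (suc i) w))
  (cong (∑ₐ xs (φ zero) +_) (∑ₐ-∑ xs (φ ∘ suc)))

-- The product of the factorials of the letter counts: the number of ways to spell the vector from
-- labelled copies of its letters, the first letter being any one of its copies.
multiplicity : ∀ {n} → Vec ℤ n → ℕ
multiplicity []      = 1
multiplicity (y ∷ v) = count (ℤ._≟ y) (y ∷ v) * multiplicity v

-- The first letter must be one of the copies of `y`. Deleting it lowers the same count on both
-- sides, so the hypothesis passes to the tail. As `h` may identify letters of `X`, counts are taken
-- after `h`.
arrangements-hitting : ∀ {X : Set} {n} (h : X → ℤ) (xs : Vec X n) (v : Vec ℤ n) →
  (∀ y → count (λ x → h x ℤ.≟ y) xs ≡ count (ℤ._≟ y) v) →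
  ∑ₐ xs (λ w → ⟦ Vec.map h w ≟ᵛ v ⟧) ≡ multiplicity v
arrangements-hitting h []       []      same = refl
arrangements-hitting {n = suc n} h xs (y ∷ v) same = begin
  ∑[ i < suc n ] ∑ₐ (removeAt xs i) (λ w → ⟦ (h (lookup xs i) ∷ Vec.map h w) ≟ᵛ (y ∷ v) ⟧)
    ≡⟨ sum-cong-≗ first-letter ⟩
  ∑[ i < suc n ] (⟦ h (lookup xs i) ℤ.≟ y ⟧ * multiplicity v)
    ≡⟨ *-distribʳ-sum (multiplicity v) (λ i → ⟦ h (lookup xs i) ℤ.≟ y ⟧) ⟨
  (∑[ i < suc n ] ⟦ h (lookup xs i) ℤ.≟ y ⟧) * multiplicity v
    ≡⟨ cong (_* multiplicity v) (trans (count-∑ (λ x → h x ℤ.≟ y) xs) (same y)) ⟩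
  count (ℤ._≟ y) (y ∷ v) * multiplicity v ∎
  where
  open ≡-Reasoning
  first-letter : ∀ i → ∑ₐ (removeAt xs i) (λ w → ⟦ (h (lookup xs i) ∷ Vec.map h w) ≟ᵛ (y ∷ v) ⟧)
                       ≡ ⟦ h (lookup xs i) ℤ.≟ y ⟧ * multiplicity v
  first-letter i with h (lookup xs i) in eq
  ... | x with x ℤ.≟ y
  ...   | no x≢y = ∑ₐ-zero (removeAt xs i) λ _ → refl
  ...   | yes refl = begin
    ∑ₐ (removeAt xs i) (λ w → ⟦ Vec.map h w ≟ᵛ v ⟧)
      ≡⟨ arrangements-hitting h (removeAt xs i) v same′ ⟩
    multiplicity v
      ≡⟨ *-identityˡ _ ⟨
    1 * multiplicity v ∎
    where
    same′ : ∀ z → count (λ x → h x ℤ.≟ z) (removeAt xs i) ≡ count (ℤ._≟ z) v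
    same′ z = +-cancelˡ-≡ ⟦ x ℤ.≟ z ⟧ _ _ (begin
      ⟦ x ℤ.≟ z ⟧ + count (λ x → h x ℤ.≟ z) (removeAt xs i)
        ≡⟨ cong (λ t → ⟦ t ℤ.≟ z ⟧ + count (λ x → h x ℤ.≟ z) (removeAt xs i)) eq ⟨
      ⟦ h (lookup xs i) ℤ.≟ z ⟧ + count (λ x → h x ℤ.≟ z) (removeAt xs i)
        ≡⟨ count-removeAt (λ x → h x ℤ.≟ z) xs i ⟨
      count (λ x → h x ℤ.≟ z) xs    ≡⟨ same z ⟩
      count (ℤ._≟ z) (x ∷ v)        ≡⟨ count-∷ (ℤ._≟ z) x v ⟩
      ⟦ x ℤ.≟ z ⟧ + count (ℤ._≟ z) v ∎)

-- Vectors of a given type and double counting.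

-- 𝒱 n k is Signed n k 1.
record Signed (n a b : ℕ) (v : Vec ℤ n) : Set where
  constructor mkSigned
  field
    coordinates : VecAll.All (_∈ entries) v
    plus-ones   : count (ℤ._≟ 1ℤ) v ≡ a
    minus-ones  : count (ℤ._≟ -1ℤ) v ≡ b

count-total : ∀ {n} {v : Vec ℤ n} → VecAll.All (_∈ entries) v →
              count (ℤ._≟ 1ℤ) v + count (ℤ._≟ -1ℤ) v + count (ℤ._≟ 0ℤ) v ≡ n
count-total VecAll.[] = refl
count-total (here refl VecAll.∷ v±) = trans (+-suc _ _) (cong suc (count-total v±))
count-total (there (here refl) VecAll.∷ v±) = cong suc (count-total v±)
count-total {v = _ ∷ v} (there (there (here refl)) VecAll.∷ v±) =
  trans (cong (_+ count (ℤ._≟ 0ℤ) v) (+-suc (count (ℤ._≟ 1ℤ) v) _)) (cong suc (count-total v±))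

zeros : ∀ {n a b c v} → Signed n a b v → a + b + c ≡ n → count (ℤ._≟ 0ℤ) v ≡ c
zeros {v = v} (mkSigned v± refl refl) total =
  +-cancelˡ-≡ (count (ℤ._≟ 1ℤ) v + count (ℤ._≟ -1ℤ) v) _ _ (trans (count-total v±) (sym total))

no-other-value : ∀ {n y} {v : Vec ℤ n} → VecAll.All (_∈ entries) v → ¬ y ∈ entries → count (ℤ._≟ y) v ≡ 0
no-other-value VecAll.[] y∉ = refl
no-other-value {y = y} {x ∷ v} (x± VecAll.∷ v±) y∉ = trans (count-∷ (ℤ._≟ y) x v)
  (cong₂ _+_ (⟦⟧-no (x ℤ.≟ y) λ { refl → y∉ x± }) (no-other-value v± y∉))

-- The zeros fill what remains of the length, so two vectors of one type are rearrangements of each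
-- other. This is the hypothesis that `arrangements-hitting` asks for.
Signed-counts : ∀ {n a b u v} → Signed n a b u → Signed n a b v → ∀ y → count (ℤ._≟ y) u ≡ count (ℤ._≟ y) v
Signed-counts {n} {a} {b} {u} {v} su@(mkSigned u± u₊ u₋) sv@(mkSigned v± v₊ v₋) y with y ∈? entries
... | yes (here refl) = zeros su total
  where
  total : a + b + count (ℤ._≟ 0ℤ) v ≡ n
  total = trans (cong (_+ count (ℤ._≟ 0ℤ) v) (sym (cong₂ _+_ v₊ v₋))) (count-total v±)
... | yes (there (here refl)) = trans u₊ (sym v₊)
... | yes (there (there (here refl))) = trans u₋ (sym v₋)
... | no y∉ = trans (no-other-value u± y∉) (sym (no-other-value v± y∉))

multiplicity-factorials : ∀ {n} {v : Vec ℤ n} → VecAll.All (_∈ entries) v →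
  multiplicity v ≡ count (ℤ._≟ 1ℤ) v ! * (count (ℤ._≟ -1ℤ) v ! * count (ℤ._≟ 0ℤ) v !)
multiplicity-factorials VecAll.[] = refl
multiplicity-factorials {v = _ ∷ v} (here refl VecAll.∷ v±) =
  trans (cong (suc (count (ℤ._≟ 0ℤ) v) *_) (multiplicity-factorials v±))
    (solve 4 (λ s a b c → s :* (a :* (b :* c)) := a :* (b :* (s :* c))) refl
      (suc (count (ℤ._≟ 0ℤ) v)) (count (ℤ._≟ 1ℤ) v !) (count (ℤ._≟ -1ℤ) v !) (count (ℤ._≟ 0ℤ) v !))
  where open +-*-Solver
multiplicity-factorials {v = _ ∷ v} (there (here refl) VecAll.∷ v±) =
  trans (cong (suc (count (ℤ._≟ 1ℤ) v) *_) (multiplicity-factorials v±))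
    (sym (*-assoc (suc (count (ℤ._≟ 1ℤ) v)) (count (ℤ._≟ 1ℤ) v !) _))
multiplicity-factorials {v = _ ∷ v} (there (there (here refl)) VecAll.∷ v±) =
  trans (cong (suc (count (ℤ._≟ -1ℤ) v) *_) (multiplicity-factorials v±))
    (solve 4 (λ s a b c → s :* (a :* (b :* c)) := a :* ((s :* b) :* c)) refl
      (suc (count (ℤ._≟ -1ℤ) v)) (count (ℤ._≟ 1ℤ) v !) (count (ℤ._≟ -1ℤ) v !) (count (ℤ._≟ 0ℤ) v !))
  where open +-*-Solver

-- Membership as a number, 0 or 1 when the list has no repetitions. Being a sum over the list, it
-- commutes with sums over arrangements.
occurrences : ∀ {n} → Vec ℤ n → List (Vec ℤ n) → ℕ
occurrences u []      = 0
occurrences u (v ∷ G) = ⟦ u ≟ᵛ v ⟧ + occurrences u G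

occurrences-∉ : ∀ {n} {u : Vec ℤ n} G → ¬ u ∈ G → occurrences u G ≡ 0
occurrences-∉         []      u∉G = refl
occurrences-∉ {u = u} (v ∷ G) u∉G =
  cong₂ _+_ (⟦⟧-no (u ≟ᵛ v) (u∉G ∘ here)) (occurrences-∉ G (u∉G ∘ there))

occurrences-unique : ∀ {n} (u : Vec ℤ n) {G} → Unique G → occurrences u G ≤ 1
occurrences-unique u AllPairs.[] = z≤n
occurrences-unique u {v ∷ G} (v≢ AllPairs.∷ G!) with u ≟ᵛ v
... | no _     = occurrences-unique u G!
... | yes refl = s≤s (≤-reflexive (occurrences-∉ G λ u∈G → All.lookup v≢ u∈G refl))

-- Double counting: every member of `G` has the type of the image of `xs`, hence is spelled by the
-- same number of arrangements.
total-occurrences : ∀ {X : Set} {n a b c} (h : X → ℤ) (xs : Vec X n) → Signed n a b (Vec.map h xs) →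
  a + b + c ≡ n → ∀ G → All.All (Signed n a b) G →
  ∑ₐ xs (λ w → occurrences (Vec.map h w) G) ≡ length G * (a ! * (b ! * c !))
total-occurrences h xs sh total []      All.[] = ∑ₐ-zero xs λ _ → refl
total-occurrences h xs sh total (v ∷ G) (sv@(mkSigned v± refl refl) All.∷ sG) = trans
  (∑ₐ-+ xs (λ w → ⟦ Vec.map h w ≟ᵛ v ⟧) (λ w → occurrences (Vec.map h w) G))
  (cong₂ _+_
    (trans (arrangements-hitting h xs v λ y → trans (sym (count-map (ℤ._≟ y) h xs)) (Signed-counts sh sv y))
      (trans (multiplicity-factorials v±)
        (cong (λ c → count (ℤ._≟ 1ℤ) v ! * (count (ℤ._≟ -1ℤ) v ! * c !)) (zeros sv total))))
    (total-occurrences h xs sh total G sG))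

-- Grids supported on a line, and scalar products.

∑≤1 : ∀ {n} {f : Fin n → ℕ} → (∀ i → f i ≤ 1) → ∑ f ≤ n
∑≤1 {n} f≤1 = ≤-trans (∑-mono f≤1) (≤-reflexive (trans (∑-const n 1) (*-identityʳ n)))

-- Two nonzero entries in different rows lie in a common column, so the support is contained
-- either in a row or in a column.
line-bound : ∀ {n} {f : Fin n → Fin n → ℕ} → (∀ i j → f i j ≤ 1) →
             (∀ {i i′ j j′} → f i j ≢ 0 → f i′ j′ ≢ 0 → i ≢ i′ → j ≡ j′) →
             ∑[ i < n ] ∑[ j < n ] f i j ≤ n
line-bound {n} {f} f≤1 same-column with Fin.any? (λ i → Fin.any? (λ j → ¬? (f i j ≟ 0)))
... | no all-zero = ≤-trans (≤-reflexive (∑-zero λ i → ∑-zero λ j →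
        decidable-stable (f i j ≟ 0) λ fij → all-zero (i , j , fij))) z≤n
... | yes (i₀ , j₀ , f₀) with Fin.any? (λ i → ¬? (i Fin.≟ i₀) ×-dec Fin.any? (λ j → ¬? (f i j ≟ 0)))
...   | no one-row = ≤-trans (≤-reflexive (∑-single i₀ λ i i≢i₀ → ∑-zero λ j →
        decidable-stable (f i j ≟ 0) λ fij → one-row (i , i≢i₀ , j , fij))) (∑≤1 (f≤1 i₀))
...   | yes (i₁ , i₁≢i₀ , j₁ , f₁) = ∑≤1 λ i → ≤-trans (≤-reflexive (∑-single j₀ λ j j≢j₀ →
        decidable-stable (f i j ≟ 0) λ fij → j≢j₀ (column i j fij))) (f≤1 i j₀)
  where
  column : ∀ i j → f i j ≢ 0 → j ≡ j₀
  column i j fij with i Fin.≟ i₀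
  ... | no i≢i₀ = same-column fij f₀ i≢i₀
  ... | yes refl = trans (same-column fij f₁ (i₁≢i₀ ∘ sym)) (same-column f₁ f₀ i₁≢i₀)

⟨⟩-map : ∀ {X : Set} {n} {f g : X → ℤ} (e : X → ℕ) → (∀ x → f x ℤ.* g x ≡ ℤ.- (ℤ.+ e x)) → (w : Vec X n) →
         ⟨ Vec.map f w , Vec.map g w ⟩ ≡ ℤ.- (ℤ.+ Vec.sum (Vec.map e w))
⟨⟩-map e fg≡-e []      = refl
⟨⟩-map e fg≡-e (x ∷ w) = trans (cong₂ ℤ._+_ (fg≡-e x) (⟨⟩-map e fg≡-e w))
  (sym (ℤ.neg-distrib-+ (ℤ.+ e x) _))

⟨⟩-orthogonal : ∀ {X : Set} {n} {f g : X → ℤ} → (∀ x → f x ℤ.* g x ≡ 0ℤ) → (w : Vec X n) →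
                ⟨ Vec.map f w , Vec.map g w ⟩ ≡ 0ℤ
⟨⟩-orthogonal fg≡0 []      = refl
⟨⟩-orthogonal fg≡0 (x ∷ w) = cong₂ ℤ._+_ (fg≡0 x) (⟨⟩-orthogonal fg≡0 w)

⟨⟩-update : ∀ {n} (u v : Vec ℤ n) p x →
            ⟨ u [ p ]≔ x , v ⟩ ≡ ⟨ u , v ⟩ ℤ.+ (x ℤ.- lookup u p) ℤ.* lookup v p
⟨⟩-update (y ∷ u) (z ∷ v) zero x =
  solve 4 (λ x y z s → x :* z :+ s := (y :* z :+ s) :+ (x :- y) :* z) refl x y z ⟨ u , v ⟩
  where open ℤ.+-*-Solver
⟨⟩-update (y ∷ u) (z ∷ v) (suc p) x =
  trans (cong (λ t → y ℤ.* z ℤ.+ t) (⟨⟩-update u v p x)) (sym (ℤ.+-assoc (y ℤ.* z) ⟨ u , v ⟩ _))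

⟨⟩-comm : ∀ {n} (u v : Vec ℤ n) → ⟨ u , v ⟩ ≡ ⟨ v , u ⟩
⟨⟩-comm []      []      = refl
⟨⟩-comm (x ∷ u) (y ∷ v) = cong₂ ℤ._+_ (ℤ.*-comm x y) (⟨⟩-comm u v)

count-witness : ∀ {a p n} {A : Set a} {P : Pred A p} (P? : Decidable P) (xs : Vec A n) →
                count P? xs ≢ 0 → ∃[ i ] P (lookup xs i)
count-witness P? [] c≢0 = contradiction refl c≢0
count-witness P? (x ∷ xs) c≢0 with P? x
... | yes px = zero , px
... | no _ with i , pi ← count-witness P? xs c≢0 = suc i , pi

occurs⇒∈ : ∀ {n} {u : Vec ℤ n} {G} → occurrences u G ≢ 0 → u ∈ G
occurs⇒∈ {u = u} {G} occ≢0 = decidable-stable (u ∈ᵛ? G) (occ≢0 ∘ occurrences-∉ G)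

-- The averaging bound for the slices with new coordinate -1 and 1.

module Averaging (r z : ℕ) where

  k n c : ℕ
  k = suc r
  n = k * k + z
  -- This is `n - k` without subtraction. It is the number of zeros in members of both families,
  -- with `k` ones, or with `r` ones and a single -1.
  c = r * k + z

  -- A word assigns to each coordinate its role: the column cell of a row, one of the `r` block
  -- cells of a row, or a place outside the grid. Arrangements of `word` are thus the random choices
  -- of `k` disjoint rows.
  data Letter : Set where
    column block : Fin k → Letter
    blank        : Letter

  word : Vec Letter n
  word = Vec.concat (Vec.tabulate λ i → column i ∷ Vec.replicate r (block i)) Vec.++ Vec.replicate z blank

  count-word : ∀ {p} {P : Pred Letter p} (P? : Decidable P) →
               count P? word ≡ (∑[ i < k ] (⟦ P? (column i) ⟧ + r * ⟦ P? (block i) ⟧)) + z * ⟦ P? blank ⟧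
  count-word P? = trans
    (count-++ P? (Vec.concat (Vec.tabulate λ i → column i ∷ Vec.replicate r (block i))) (Vec.replicate z blank))
    (cong₂ _+_
    (trans (count-concat-tabulate P? λ i → column i ∷ Vec.replicate r (block i))
      (sum-cong-≗ λ i → trans (count-∷ P? (column i) (Vec.replicate r (block i)))
        (cong (⟦ P? (column i) ⟧ +_) (count-replicate P? r (block i)))))
    (count-replicate P? z blank))

  columns : Letter → ℤ
  columns (column i) = 1ℤ
  columns (block i)  = 0ℤ
  columns blank      = 0ℤ

  -- The case `i ≡ j` is allowed, so each word yields a full `k` by `k` grid of vectors to be looked
  -- for in `ℬ`.
  mark : Fin k → Fin k → Letter → ℤ
  mark i j (column l) = if does (l Fin.≟ j) then -1ℤ else 0ℤ
  mark i j (block l)  = if does (l Fin.≟ i) then 1ℤ else 0ℤ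
  mark i j blank      = 0ℤ

  columns-entries : ∀ x → columns x ∈ entries
  columns-entries (column i) = there (here refl)
  columns-entries (block i)  = here refl
  columns-entries blank      = here refl

  mark-entries : ∀ i j x → mark i j x ∈ entries
  mark-entries i j (column l) with l Fin.≟ j
  ... | yes _ = there (there (here refl))
  ... | no _  = here refl
  mark-entries i j (block l) with l Fin.≟ i
  ... | yes _ = there (here refl)
  ... | no _  = here refl
  mark-entries i j blank = here refl

  map-entries : ∀ {h : Letter → ℤ} → (∀ x → h x ∈ entries) → ∀ {m} (w : Vec Letter m) →
                VecAll.All (_∈ entries) (Vec.map h w)
  map-entries h± []      = VecAll.[]
  map-entries h± (x ∷ w) = h± x VecAll.∷ map-entries h± w

  columns-signed : Signed n k 0 (Vec.map columns word)
  columns-signed = mkSigned (map-entries columns-entries word)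
    (trans (count-map (ℤ._≟ 1ℤ) columns word) (trans (count-word λ x → columns x ℤ.≟ 1ℤ) (begin
      (∑[ i < k ] (1 + r * 0)) + z * 0 ≡⟨ cong₂ _+_ (∑-const k (1 + r * 0)) (*-zeroʳ z) ⟩
      k * (1 + r * 0) + 0
        ≡⟨ solve 1 (λ r → (con 1 :+ r) :* (con 1 :+ r :* con 0) :+ con 0 := con 1 :+ r) refl r ⟩
      k ∎)))
    (trans (count-map (ℤ._≟ -1ℤ) columns word) (trans (count-word λ x → columns x ℤ.≟ -1ℤ)
      (cong₂ _+_ (∑-zero {k} λ _ → *-zeroʳ r) (*-zeroʳ z))))
    where
    open ≡-Reasoning
    open +-*-Solver

  mark-signed : ∀ i j → Signed n r 1 (Vec.map (mark i j) word)
  mark-signed i j = mkSigned (map-entries (mark-entries i j) word)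
    (trans (count-map (ℤ._≟ 1ℤ) (mark i j) word) (trans (count-word λ x → mark i j x ℤ.≟ 1ℤ) (begin
      ∑ ones + z * 0   ≡⟨ cong₂ _+_ (∑-single i other-row) (*-zeroʳ z) ⟩
      ones i + 0       ≡⟨ +-identityʳ _ ⟩
      ones i           ≡⟨ this-row ⟩
      r ∎)))
    (trans (count-map (ℤ._≟ -1ℤ) (mark i j) word) (trans (count-word λ x → mark i j x ℤ.≟ -1ℤ) (begin
      ∑ minus-ones + z * 0 ≡⟨ cong₂ _+_ (∑-single j other-column) (*-zeroʳ z) ⟩
      minus-ones j + 0     ≡⟨ +-identityʳ _ ⟩
      minus-ones j         ≡⟨ this-column ⟩
      1 ∎)))
    where
    open ≡-Reasoning
    ones minus-ones : Fin k → ℕ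
    ones l       = ⟦ mark i j (column l) ℤ.≟ 1ℤ ⟧ + r * ⟦ mark i j (block l) ℤ.≟ 1ℤ ⟧
    minus-ones l = ⟦ mark i j (column l) ℤ.≟ -1ℤ ⟧ + r * ⟦ mark i j (block l) ℤ.≟ -1ℤ ⟧
    column≢1 : ∀ l → ⟦ mark i j (column l) ℤ.≟ 1ℤ ⟧ ≡ 0
    column≢1 l with l Fin.≟ j
    ... | yes _ = refl
    ... | no _  = refl
    block≢-1 : ∀ l → ⟦ mark i j (block l) ℤ.≟ -1ℤ ⟧ ≡ 0
    block≢-1 l with l Fin.≟ i
    ... | yes _ = refl
    ... | no _  = refl
    other-row : ∀ l → l ≢ i → ones l ≡ 0
    other-row l l≢i with l Fin.≟ i
    ... | yes l≡i = contradiction l≡i l≢i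
    ... | no _    = cong₂ _+_ (column≢1 l) (*-zeroʳ r)
    this-row : ones i ≡ r
    this-row with i Fin.≟ i
    ... | yes _  = cong₂ _+_ (column≢1 i) (*-identityʳ r)
    ... | no i≢i = contradiction refl i≢i
    other-column : ∀ l → l ≢ j → minus-ones l ≡ 0
    other-column l l≢j rewrite block≢-1 l with l Fin.≟ j
    ... | yes l≡j = contradiction l≡j l≢j
    ... | no _    = *-zeroʳ r
    this-column : minus-ones j ≡ 1
    this-column rewrite block≢-1 j with j Fin.≟ j
    ... | yes _  = cong suc (*-zeroʳ r)
    ... | no j≢j = contradiction refl j≢j

  columns*mark : ∀ i j x → columns x ℤ.* mark i j x ≡ ℤ.- (ℤ.+ ⟦ mark i j x ℤ.≟ -1ℤ ⟧)
  columns*mark i j (column l) with l Fin.≟ j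
  ... | yes _ = refl
  ... | no _  = refl
  columns*mark i j (block l) with l Fin.≟ i
  ... | yes _ = refl
  ... | no _  = refl
  columns*mark i j blank = refl

  -- The supports are disjoint: the blocks differ, the column cells differ, and no letter is both a
  -- block and a column letter.
  mark*mark : ∀ {i i′ j j′} → i ≢ i′ → j ≢ j′ → ∀ x → mark i j x ℤ.* mark i′ j′ x ≡ 0ℤ
  mark*mark {j = j} {j′} i≢i′ j≢j′ (column l) with l Fin.≟ j | l Fin.≟ j′
  ... | yes refl | yes refl = contradiction refl j≢j′
  ... | yes _    | no _     = refl
  ... | no _     | _        = refl
  mark*mark {i} {i′} i≢i′ j≢j′ (block l) with l Fin.≟ i | l Fin.≟ i′
  ... | yes refl | yes refl = contradiction refl i≢i′
  ... | yes _    | no _     = refl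
  ... | no _     | _        = refl
  mark*mark i≢i′ j≢j′ blank = refl

  mark≡-1 : ∀ {i j} x → mark i j x ≡ -1ℤ → x ≡ column j
  mark≡-1 {j = j} (column l) eq with l Fin.≟ j
  ... | yes refl = refl
  ... | no _     = contradiction eq λ ()
  mark≡-1 {i} (block l) eq with l Fin.≟ i
  ... | yes _ = contradiction eq λ ()
  ... | no _  = contradiction eq λ ()

  mark-other-column : ∀ i {j j′} → j ≢ j′ → mark i j (column j′) ≡ 0ℤ
  mark-other-column i {j} {j′} j≢j′ with j′ Fin.≟ j
  ... | yes j′≡j = contradiction (sym j′≡j) j≢j′
  ... | no _     = refl

  -- `𝒜ℬ` is the intersecting condition with the head product -1 removed. `ℬℬ` combines that
  -- condition with stability: the +1 at the new coordinate may be exchanged with any 0 of the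
  -- remainder.
  module _ {𝒜 ℬ : List (Vec ℤ n)} (𝒜! : Unique 𝒜) (ℬ! : Unique ℬ)
           (𝒜-signed : All (Signed n k 0) 𝒜) (ℬ-signed : All (Signed n r 1) ℬ)
           (𝒜ℬ : ∀ {u v} → u ∈ 𝒜 → v ∈ ℬ → ⟨ u , v ⟩ ≢ -1ℤ)
           (ℬℬ : ∀ {u v p q} → u ∈ ℬ → v ∈ ℬ → lookup u p ≡ 0ℤ → lookup v q ≡ 0ℤ →
                 ⟨ u [ p ]≔ 1ℤ , v [ q ]≔ 1ℤ ⟩ ≢ ℤ.- (ℤ.+ 2))
           where

    -- Where the marked vector is -1 the column indicator is 1, and where it is +1 the indicator is
    -- 0. The product is therefore minus the number of entries -1, that is -1, which `𝒜ℬ` forbids.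
    columns∉𝒜 : ∀ {i j} {w : Vec Letter n} → Vec.map (mark i j) w ∈ ℬ → ¬ Vec.map columns w ∈ 𝒜
    columns∉𝒜 {i} {j} {w} u∈ℬ a∈𝒜 = 𝒜ℬ a∈𝒜 u∈ℬ (begin
      ⟨ Vec.map columns w , Vec.map (mark i j) w ⟩
        ≡⟨ ⟨⟩-map _ (columns*mark i j) w ⟩
      ℤ.- (ℤ.+ Vec.sum (Vec.map (λ x → ⟦ mark i j x ℤ.≟ -1ℤ ⟧) w))
        ≡⟨ cong (λ t → ℤ.- (ℤ.+ t)) (sum-indicator w) ⟩
      ℤ.- (ℤ.+ count (ℤ._≟ -1ℤ) (Vec.map (mark i j) w))
        ≡⟨ cong (λ t → ℤ.- (ℤ.+ t)) (Signed.minus-ones (All.lookup ℬ-signed u∈ℬ)) ⟩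
      -1ℤ ∎)
      where
      open ≡-Reasoning
      sum-indicator : ∀ {m} (w : Vec Letter m) → Vec.sum (Vec.map (λ x → ⟦ mark i j x ℤ.≟ -1ℤ ⟧) w)
                      ≡ count (ℤ._≟ -1ℤ) (Vec.map (mark i j) w)
      sum-indicator []      = refl
      sum-indicator (x ∷ w) = trans (cong (⟦ mark i j x ℤ.≟ -1ℤ ⟧ +_) (sum-indicator w))
        (sym (count-∷ (ℤ._≟ -1ℤ) (mark i j x) (Vec.map (mark i j) w)))

    -- Here `w` is any word, not necessarily an arrangement of `word`, so that the letter `column j`
    -- occurs at all must be read off from the single -1 of a member of `ℬ`.
    minus-position : ∀ {i j} {w : Vec Letter n} → Vec.map (mark i j) w ∈ ℬ → ∃[ p ] lookup w p ≡ column j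
    minus-position {i} {j} {w} u∈ℬ
      with p , u-p ← count-witness (ℤ._≟ -1ℤ) (Vec.map (mark i j) w)
             (λ c≡0 → contradiction (trans (sym c≡0) (Signed.minus-ones (All.lookup ℬ-signed u∈ℬ))) λ ())
      = p , mark≡-1 (lookup w p) (trans (sym (lookup-map p (mark i j) w)) u-p)

    -- If the columns differed too, the two vectors would have disjoint supports. Moving the +1 of
    -- each from the new coordinate onto the -1 of the other would then give the product -2.
    same-column : ∀ {i i′ j j′} {w : Vec Letter n} →
                  Vec.map (mark i j) w ∈ ℬ → Vec.map (mark i′ j′) w ∈ ℬ → i ≢ i′ → j ≡ j′
    same-column {i} {i′} {j} {j′} {w} u∈ℬ v∈ℬ i≢i′ with j Fin.≟ j′
    ... | yes j≡j′ = j≡j′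
    -- `q` is the position of the -1 of `u`, and `p` that of `v`; each is a zero of the other
    -- vector.
    ... | no j≢j′ with q , w-q ← minus-position u∈ℬ | p , w-p ← minus-position v∈ℬ =
      contradiction product (ℬℬ u∈ℬ v∈ℬ (at u-p) (at v-q))
      where
      open ≡-Reasoning
      u v : Vec ℤ n
      u = Vec.map (mark i j) w
      v = Vec.map (mark i′ j′) w
      u-p : mark i j (lookup w p) ≡ 0ℤ
      u-p = trans (cong (mark i j) w-p) (mark-other-column i j≢j′)
      v-q : mark i′ j′ (lookup w q) ≡ 0ℤ
      v-q = trans (cong (mark i′ j′) w-q) (mark-other-column i′ (j≢j′ ∘ sym))
      at : ∀ {h : Letter → ℤ} {p x} → h (lookup w p) ≡ x → lookup (Vec.map h w) p ≡ x
      at {h} {p} = trans (lookup-map p h w)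
      mark-self : ∀ i j → mark i j (column j) ≡ -1ℤ
      mark-self i j with j Fin.≟ j
      ... | yes _  = refl
      ... | no j≢j = contradiction refl j≢j
      u-q : lookup u q ≡ -1ℤ
      u-q = at (trans (cong (mark i j) w-q) (mark-self i j))
      v-p : lookup v p ≡ -1ℤ
      v-p = at (trans (cong (mark i′ j′) w-p) (mark-self i′ j′))
      p≢q : p ≢ q
      p≢q refl = contradiction (trans (sym (at {mark i j} u-p)) u-q) λ ()
      product : ⟨ u [ p ]≔ 1ℤ , v [ q ]≔ 1ℤ ⟩ ≡ ℤ.- (ℤ.+ 2)
      product = begin
        ⟨ u [ p ]≔ 1ℤ , v [ q ]≔ 1ℤ ⟩
          ≡⟨ ⟨⟩-update u (v [ q ]≔ 1ℤ) p 1ℤ ⟩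
        ⟨ u , v [ q ]≔ 1ℤ ⟩ ℤ.+ (1ℤ ℤ.- lookup u p) ℤ.* lookup (v [ q ]≔ 1ℤ) p
          ≡⟨ cong₂ (λ s t → ⟨ u , v [ q ]≔ 1ℤ ⟩ ℤ.+ (1ℤ ℤ.- s) ℤ.* t) (at u-p)
               (trans (lookup∘update′ p≢q v 1ℤ) v-p) ⟩
        ⟨ u , v [ q ]≔ 1ℤ ⟩ ℤ.+ -1ℤ
          ≡⟨ cong (ℤ._+ -1ℤ) (⟨⟩-comm u (v [ q ]≔ 1ℤ)) ⟩
        ⟨ v [ q ]≔ 1ℤ , u ⟩ ℤ.+ -1ℤ
          ≡⟨ cong (ℤ._+ -1ℤ) (⟨⟩-update v u q 1ℤ) ⟩
        ⟨ v , u ⟩ ℤ.+ (1ℤ ℤ.- lookup v q) ℤ.* lookup u q ℤ.+ -1ℤ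
          ≡⟨ cong₂ (λ s t → ⟨ v , u ⟩ ℤ.+ (1ℤ ℤ.- s) ℤ.* t ℤ.+ -1ℤ) (at v-q) u-q ⟩
        ⟨ v , u ⟩ ℤ.+ -1ℤ ℤ.+ -1ℤ
          ≡⟨ cong (λ t → t ℤ.+ -1ℤ ℤ.+ -1ℤ) (⟨⟩-orthogonal (mark*mark (i≢i′ ∘ sym) (j≢j′ ∘ sym)) w) ⟩
        ℤ.- (ℤ.+ 2) ∎

    hits : Fin k → Fin k → Vec Letter n → ℕ
    hits i j w = occurrences (Vec.map (mark i j) w) ℬ

    -- The factor `k` in front of `𝒜` equalises the two cases: the column indicator alone
    -- contributes at most `k`, and so do the hits on one line of the grid.
    pointwise : ∀ w → k * occurrences (Vec.map columns w) 𝒜 + (∑[ i < k ] ∑[ j < k ] hits i j w) ≤ k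
    pointwise w with Vec.map columns w ∈ᵛ? 𝒜
    ... | yes a∈𝒜 = ≤-trans (+-mono-≤ (*-monoʳ-≤ k (occurrences-unique (Vec.map columns w) 𝒜!))
            (≤-reflexive (∑-zero {k} λ i → ∑-zero {k} λ j → occurrences-∉ ℬ λ u∈ℬ → columns∉𝒜 {i} {j} u∈ℬ a∈𝒜)))
            (≤-reflexive (trans (+-identityʳ _) (*-identityʳ k)))
    ... | no a∉𝒜 = ≤-trans (≤-reflexive (cong (_+ (∑[ i < k ] ∑[ j < k ] hits i j w))
              (trans (cong (k *_) (occurrences-∉ 𝒜 a∉𝒜)) (*-zeroʳ k))))
            (line-bound (λ i j → occurrences-unique (Vec.map (mark i j) w) ℬ!)
              (λ u-hit v-hit → same-column (occurs⇒∈ u-hit) (occurs⇒∈ v-hit)))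

    n! : n ! ≡ (n C k) * (k ! * c !)
    n! = trans (sym (m/n*n≡m (k![n∸k]!∣n! k≤n))) (trans (cong (_* (k ! * (n ∸ k) !)) (sym (nCk≡n!/k![n-k]! k≤n)))
      (cong (λ t → (n C k) * (k ! * t !)) n∸k≡c))
      where
      instance
        _ = k !* (n ∸ k) !≢0
      n≡k+c : n ≡ k + c
      n≡k+c = +-assoc k (r * k) z
      n∸k≡c : n ∸ k ≡ c
      n∸k≡c = trans (cong (_∸ k) n≡k+c) (m+n∸m≡n k c)
      k≤n : k ≤ n
      k≤n = ≤-trans (m≤m+n k c) (≤-reflexive (sym n≡k+c))

    -- Sum `pointwise` over all arrangements of `word`. A member of `𝒜` contributes
    -- `k * (k ! * c !)` and a member of `ℬ` contributes `k * k * (r ! * c !)`. These agree because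
    -- `k ! = k * r !`, and the common factor cancels.
    bound : length 𝒜 + length ℬ ≤ n C k
    bound = *-cancelʳ-≤ (a + b) (n C k) (k * (k ! * c !)) (begin
      (a + b) * (k * (k ! * c !))
        -- The product `k :* f` stands for `k !` unfolded to `k * r !`, and `con 1` for `0 !` and
        -- `1 !`.
        ≡⟨ solve 5 (λ a b k f g → (a :+ b) :* (k :* ((k :* f) :* g)) :=
             k :* (a :* ((k :* f) :* (con 1 :* g))) :+ k :* (k :* (b :* (f :* (con 1 :* g))))) refl a b k (r !) (c !) ⟩
      k * (a * (k ! * (0 ! * c !))) + k * (k * (b * (r ! * (1 ! * c !))))
        ≡⟨ cong₂ _+_ 𝒜-total ℬ-total ⟨
      ∑ₐ word (λ w → k * occurrences (Vec.map columns w) 𝒜) + ∑ₐ word (λ w → ∑[ i < k ] ∑[ j < k ] hits i j w)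
        ≡⟨ ∑ₐ-+ word (λ w → k * occurrences (Vec.map columns w) 𝒜) (λ w → ∑[ i < k ] ∑[ j < k ] hits i j w) ⟨
      ∑ₐ word (λ w → k * occurrences (Vec.map columns w) 𝒜 + (∑[ i < k ] ∑[ j < k ] hits i j w))
        ≤⟨ ∑ₐ-mono word pointwise ⟩
      ∑ₐ word (λ _ → k)
        ≡⟨ ∑ₐ-const word k ⟩
      n ! * k
        ≡⟨ cong (_* k) n! ⟩
      (n C k) * (k ! * c !) * k
        ≡⟨ trans (*-assoc (n C k) (k ! * c !) k) (cong ((n C k) *_) (*-comm (k ! * c !) k)) ⟩
      (n C k) * (k * (k ! * c !)) ∎)
      where
      open ≤-Reasoning
      open +-*-Solver
      a b : ℕ
      a = length 𝒜
      b = length ℬ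
      instance
        _ = m*n≢0 k (k ! * c !) {{_}} {{k !* c !≢0}}
      𝒜-total : ∑ₐ word (λ w → k * occurrences (Vec.map columns w) 𝒜) ≡ k * (a * (k ! * (0 ! * c !)))
      𝒜-total = trans (∑ₐ-* word k (λ w → occurrences (Vec.map columns w) 𝒜)) (cong (k *_)
        (total-occurrences columns word columns-signed
          (solve 2 (λ r z → (con 1 :+ r) :+ con 0 :+ (r :* (con 1 :+ r) :+ z)
             := (con 1 :+ r) :* (con 1 :+ r) :+ z) refl r z)
          𝒜 𝒜-signed))
      ℬ-total : ∑ₐ word (λ w → ∑[ i < k ] ∑[ j < k ] hits i j w) ≡ k * (k * (b * (r ! * (1 ! * c !))))
      ℬ-total = trans (∑ₐ-∑ word (λ i w → ∑[ j < k ] hits i j w))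
        (trans (sum-cong-≗ λ i → trans (∑ₐ-∑ word (hits i)) (trans (sum-cong-≗ λ j →
            total-occurrences (mark i j) word (mark-signed i j)
              (solve 2 (λ r z → r :+ con 1 :+ (r :* (con 1 :+ r) :+ z) := (con 1 :+ r) :* (con 1 :+ r) :+ z) refl r z)
              ℬ ℬ-signed)
          (∑-const k _)))
        (∑-const k _))

-- Exchanging the new coordinate with another one.

swap : ∀ {n} → Fin n → Vec ℤ (suc n) → Vec ℤ (suc n)
swap p (x ∷ u) = lookup u p ∷ (u [ p ]≔ x)

swap-involutive : ∀ {n} (p : Fin n) v → swap p (swap p v) ≡ v
swap-involutive p (x ∷ u) =
  cong₂ _∷_ (lookup∘update p u x) (trans ([]≔-idempotent u p) ([]≔-lookup u p))

swap-injective : ∀ {n} (p : Fin n) {v w} → swap p v ≡ swap p w → v ≡ w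
swap-injective p eq = trans (sym (swap-involutive p _)) (trans (cong (swap p) eq) (swap-involutive p _))

below : ∀ {n} → Fin n → Vec ℤ (suc n) → ℤ
below p v = lookup (Vec.tail v) p

⟨⟩-swap : ∀ {n} (p : Fin n) v w → ⟨ swap p v , w ⟩ ≡
          ⟨ v , w ⟩ ℤ.+ (Vec.head v ℤ.- below p v) ℤ.* (below p w ℤ.- Vec.head w)
⟨⟩-swap p (x ∷ u) (x′ ∷ u′) =
  trans (cong (λ t → lookup u p ℤ.* x′ ℤ.+ t) (⟨⟩-update u u′ p x))
    (solve 5 (λ x y x′ y′ s → y :* x′ :+ (s :+ (x :- y) :* y′) := (x :* x′ :+ s) :+ (x :- y) :* (y′ :- x′))
      refl x (lookup u p) x′ (lookup u′ p) ⟨ u , u′ ⟩)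
  where open ℤ.+-*-Solver

-- A transposition is self-adjoint: the correction term in `⟨⟩-swap` is symmetric in `v` and `w`.
⟨⟩-swapˡʳ : ∀ {n} (p : Fin n) v w → ⟨ swap p v , w ⟩ ≡ ⟨ v , swap p w ⟩
⟨⟩-swapˡʳ p v w = begin
  ⟨ swap p v , w ⟩
    ≡⟨ ⟨⟩-swap p v w ⟩
  ⟨ v , w ⟩ ℤ.+ (Vec.head v ℤ.- below p v) ℤ.* (below p w ℤ.- Vec.head w)
    ≡⟨ cong₂ ℤ._+_ (⟨⟩-comm v w) (solve 4 (λ x y x′ y′ → (x :- y) :* (y′ :- x′) := (x′ :- y′) :* (y :- x)) refl
         (Vec.head v) (below p v) (Vec.head w) (below p w)) ⟩
  ⟨ w , v ⟩ ℤ.+ (Vec.head w ℤ.- below p w) ℤ.* (below p v ℤ.- Vec.head v)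
    ≡⟨ ⟨⟩-swap p w v ⟨
  ⟨ swap p w , v ⟩
    ≡⟨ ⟨⟩-comm (swap p w) v ⟩
  ⟨ v , swap p w ⟩ ∎
  where
  open ≡-Reasoning
  open ℤ.+-*-Solver

⟨⟩-swap-both : ∀ {n} (p : Fin n) v w → ⟨ swap p v , swap p w ⟩ ≡ ⟨ v , w ⟩
⟨⟩-swap-both p v w = trans (⟨⟩-swapˡʳ p v (swap p w)) (cong ⟨ v ,_⟩ (swap-involutive p w))

-- Both factors of the correction term in `⟨⟩-swap` are nonnegative when the two vectors are ordered
-- oppositely at the exchanged places.
⟨⟩-swap-≤ : ∀ {n} (p : Fin n) {v w} → below p v ℤ.< Vec.head v → Vec.head w ℤ.≤ below p w →
            ⟨ v , w ⟩ ℤ.≤ ⟨ swap p v , w ⟩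
⟨⟩-swap-≤ p {v} {w} lower-v upper-w = begin
  ⟨ v , w ⟩             ≡⟨ ℤ.+-identityʳ _ ⟨
  ⟨ v , w ⟩ ℤ.+ 0ℤ      ≤⟨ ℤ.+-monoʳ-≤ ⟨ v , w ⟩ (nonneg (ℤ.i≤j⇒0≤j-i (ℤ.<⇒≤ lower-v)) (ℤ.i≤j⇒0≤j-i upper-w)) ⟩
  ⟨ v , w ⟩ ℤ.+ (Vec.head v ℤ.- below p v) ℤ.* (below p w ℤ.- Vec.head w) ≡⟨ ⟨⟩-swap p v w ⟨
  ⟨ swap p v , w ⟩ ∎
  where
  open ℤ.≤-Reasoning
  nonneg : ∀ {i j} → 0ℤ ℤ.≤ i → 0ℤ ℤ.≤ j → 0ℤ ℤ.≤ i ℤ.* j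
  nonneg {ℤ.+ a} {ℤ.+ b} _ _ = subst (0ℤ ℤ.≤_) (ℤ.pos-* a b) (ℤ.+≤+ z≤n)

count-swap : ∀ {p n} {P : Pred ℤ p} (P? : Decidable P) (q : Fin n) v → count P? (swap q v) ≡ count P? v
count-swap P? zero (x ∷ y ∷ u) = begin
  count P? (y ∷ x ∷ u)                ≡⟨ trans (count-∷ P? y (x ∷ u)) (cong (⟦ P? y ⟧ +_) (count-∷ P? x u)) ⟩
  ⟦ P? y ⟧ + (⟦ P? x ⟧ + count P? u)  ≡⟨ x∙yz≈y∙xz +-commutativeSemigroup ⟦ P? y ⟧ ⟦ P? x ⟧ (count P? u) ⟩
  ⟦ P? x ⟧ + (⟦ P? y ⟧ + count P? u)  ≡⟨ trans (count-∷ P? x (y ∷ u)) (cong (⟦ P? x ⟧ +_) (count-∷ P? y u)) ⟨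
  count P? (x ∷ y ∷ u)                ∎
  where
  open ≡-Reasoning
count-swap P? (suc q) (x ∷ y ∷ u) = begin
  count P? (z ∷ y ∷ u′)                ≡⟨ trans (count-∷ P? z (y ∷ u′)) (cong (⟦ P? z ⟧ +_) (count-∷ P? y u′)) ⟩
  ⟦ P? z ⟧ + (⟦ P? y ⟧ + count P? u′)  ≡⟨ x∙yz≈y∙xz +-commutativeSemigroup ⟦ P? z ⟧ ⟦ P? y ⟧ (count P? u′) ⟩
  ⟦ P? y ⟧ + (⟦ P? z ⟧ + count P? u′)  ≡⟨ cong (⟦ P? y ⟧ +_) (count-∷ P? z u′) ⟨
  ⟦ P? y ⟧ + count P? (z ∷ u′)         ≡⟨ cong (⟦ P? y ⟧ +_) (count-swap P? q (x ∷ u)) ⟩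
  ⟦ P? y ⟧ + count P? (x ∷ u)          ≡⟨ cong (⟦ P? y ⟧ +_) (count-∷ P? x u) ⟩
  ⟦ P? y ⟧ + (⟦ P? x ⟧ + count P? u)   ≡⟨ x∙yz≈y∙xz +-commutativeSemigroup ⟦ P? y ⟧ ⟦ P? x ⟧ (count P? u) ⟩
  ⟦ P? x ⟧ + (⟦ P? y ⟧ + count P? u)   ≡⟨ trans (count-∷ P? x (y ∷ u)) (cong (⟦ P? x ⟧ +_) (count-∷ P? y u)) ⟨
  count P? (x ∷ y ∷ u)                 ∎
  where
  open ≡-Reasoning
  z = lookup u q
  u′ = u [ q ]≔ x

All-swap : ∀ {ℓ n} {P : Pred ℤ ℓ} (q : Fin n) {v} → VecAll.All P v → VecAll.All P (swap q v)
All-swap zero    (px VecAll.∷ py VecAll.∷ pu) = py VecAll.∷ px VecAll.∷ pu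
All-swap (suc q) (px VecAll.∷ py VecAll.∷ pu) with pz VecAll.∷ pu′ ← All-swap q (px VecAll.∷ pu) =
  pz VecAll.∷ py VecAll.∷ pu′

𝒱-swap : ∀ {n k} (q : Fin n) {v} → 𝒱 (suc n) k v → 𝒱 (suc n) k (swap q v)
𝒱-swap q {v} (mk𝒱 v± v₊ v₋) = mk𝒱 (All-swap q v±)
  (trans (count-swap (ℤ._≟ 1ℤ) q v) v₊) (trans (count-swap (ℤ._≟ -1ℤ) q v) v₋)

-- The termination measure of shifting: heads -1, 0, 1 weigh 0, 1, 2.
weight : ∀ {n} → Vec ℤ (suc n) → ℕ
weight v = ℤ.∣ 1ℤ ℤ.+ Vec.head v ∣

weight-swap : ∀ {n} (q : Fin n) {v} → VecAll.All (_∈ entries) v → below q v ℤ.< Vec.head v →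
              weight (swap q v) < weight v
weight-swap q {x ∷ u} v±@(x± VecAll.∷ _) with y± VecAll.∷ _ ← All-swap q v± = decrease x± y±
  where
  decrease : ∀ {x y} → x ∈ entries → y ∈ entries → y ℤ.< x → ℤ.∣ 1ℤ ℤ.+ y ∣ < ℤ.∣ 1ℤ ℤ.+ x ∣
  decrease (here refl)                 (here refl)                 (ℤ.+<+ ())
  decrease (here refl)                 (there (here refl))         (ℤ.+<+ ())
  decrease (here refl)                 (there (there (here refl))) _ = s≤s z≤n
  decrease (there (here refl))         (here refl)                 _ = s≤s (s≤s z≤n)
  decrease (there (here refl))         (there (here refl))         (ℤ.+<+ (s≤s ()))
  decrease (there (here refl))         (there (there (here refl))) _ = s≤s z≤n
  decrease (there (there (here refl))) (here refl)                 ()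
  decrease (there (there (here refl))) (there (here refl))         ()
  decrease (there (there (here refl))) (there (there (here refl))) (ℤ.-<- ())

Stable : ∀ {n} → List (Vec ℤ (suc n)) → Set
Stable F = ∀ {v} p → v ∈ F → below p v ℤ.< Vec.head v → swap p v ∈ F

-- Injectivity is asked for on members only, since a shift is shown injective only on the family
-- that defines it.
unique-map : ∀ {a b} {A : Set a} {B : Set b} {f : A → B} {xs} →
             (∀ {x y} → x ∈ xs → y ∈ xs → f x ≡ f y → x ≡ y) → Unique xs → Unique (map f xs)
unique-map inj AllPairs.[] = AllPairs.[]
unique-map inj (x≢ AllPairs.∷ xs!) =
  All.map⁺ (All.tabulate λ y∈ fx≡fy → All.lookup x≢ y∈ (inj (here refl) (there y∈) fx≡fy))
  AllPairs.∷ unique-map (λ x∈ y∈ → inj (there x∈) (there y∈)) xs!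

sum-map-≤ : ∀ {a} {A : Set a} {f g : A → ℕ} {xs} → (∀ {x} → x ∈ xs → f x ≤ g x) → sum (map f xs) ≤ sum (map g xs)
sum-map-≤ {xs = []}     f≤g = z≤n
sum-map-≤ {xs = x ∷ xs} f≤g = +-mono-≤ (f≤g (here refl)) (sum-map-≤ (f≤g ∘ there))

sum-map-< : ∀ {a} {A : Set a} {f g : A → ℕ} {xs x} → (∀ {x} → x ∈ xs → f x ≤ g x) → x ∈ xs → f x < g x →
            sum (map f xs) < sum (map g xs)
sum-map-< f≤g (here refl) fx<gx = +-mono-<-≤ fx<gx (sum-map-≤ (f≤g ∘ there))
sum-map-< f≤g (there x∈)  fx<gx = +-mono-≤-< (f≤g (here refl)) (sum-map-< (f≤g ∘ there) x∈ fx<gx)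

-- Shifting a family until it is stable.

module Shift {n k : ℕ} {F : List (Vec ℤ (suc n))} (F-family : IntersectingFamily (suc n) k F) (p : Fin n) where

  open IntersectingFamily F-family

  Movable : Pred (Vec ℤ (suc n)) _
  Movable v = below p v ℤ.< Vec.head v × ¬ swap p v ∈ F

  abstract
    movable? : Decidable Movable
    movable? v = (below p v ℤ.<? Vec.head v) ×-dec ¬? (swap p v ∈ᵛ? F)

  shift : Vec ℤ (suc n) → Vec ℤ (suc n)
  shift v = if does (movable? v) then swap p v else v

  shift-movable : ∀ {v} → Movable v → shift v ≡ swap p v
  shift-movable {v} mv with movable? v
  ... | yes _  = refl
  ... | no ¬mv = contradiction mv ¬mv

  -- In the mixed cases one image lies outside `F` and the other in `F`, so they cannot be equal.
  shift-injective : ∀ {v w} → v ∈ F → w ∈ F → shift v ≡ shift w → v ≡ w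
  shift-injective {v} {w} v∈F w∈F eq with movable? v | movable? w
  ... | yes _          | yes _          = swap-injective p eq
  ... | yes (_ , sv∉F) | no _           = contradiction (subst (_∈ F) (sym eq) w∈F) sv∉F
  ... | no _           | yes (_ , sw∉F) = contradiction (subst (_∈ F) eq v∈F) sw∉F
  ... | no _           | no _           = eq

  shift-𝒱 : ∀ {v} → 𝒱 (suc n) k v → 𝒱 (suc n) k (shift v)
  shift-𝒱 {v} v𝒱 with movable? v
  ... | yes _ = 𝒱-swap p v𝒱
  ... | no _  = v𝒱

  -- If w is immovable, either its swap is already in F and the swap is moved across the product,
  -- or swapping v alone cannot decrease the product.
  swap-intersecting : ∀ {v w} → v ∈ F → w ∈ F → Movable v → ¬ Movable w → ⟨ swap p v , w ⟩ ℤ.> ℤ.- (ℤ.+ 2)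
  swap-intersecting {v} {w} v∈F w∈F (lower-v , _) ¬mw with below p w ℤ.<? Vec.head w
  ... | no ¬lower-w = ℤ.<-≤-trans (intersecting v w v∈F w∈F) (⟨⟩-swap-≤ p {v} {w} lower-v (ℤ.≮⇒≥ ¬lower-w))
  ... | yes lower-w = subst (ℤ._> ℤ.- (ℤ.+ 2)) (sym (⟨⟩-swapˡʳ p v w))
          (intersecting v (swap p w) v∈F (decidable-stable (swap p w ∈ᵛ? F) λ sw∉F → ¬mw (lower-w , sw∉F)))

  shift-intersecting : ∀ {v w} → v ∈ F → w ∈ F → ⟨ shift v , shift w ⟩ ℤ.> ℤ.- (ℤ.+ 2)
  shift-intersecting {v} {w} v∈F w∈F with movable? v | movable? w
  ... | yes _  | yes _  = subst (ℤ._> ℤ.- (ℤ.+ 2)) (sym (⟨⟩-swap-both p v w)) (intersecting v w v∈F w∈F)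
  ... | yes mv | no ¬mw = swap-intersecting v∈F w∈F mv ¬mw
  ... | no ¬mv | yes mw = subst (ℤ._> ℤ.- (ℤ.+ 2)) (⟨⟩-comm (swap p w) v) (swap-intersecting w∈F v∈F mw ¬mv)
  ... | no _   | no _   = intersecting v w v∈F w∈F

  shifted-family : IntersectingFamily (suc n) k (map shift F)
  shifted-family = mkFamily
    (unique-map shift-injective unique) (All.map⁺ (All.map shift-𝒱 members)) shifted-intersecting
    where
    shifted-intersecting : Intersecting (map shift F)
    shifted-intersecting _ _ v∈ w∈ with _ , v′∈ , refl ← ∈-map⁻ shift v∈ | _ , w′∈ , refl ← ∈-map⁻ shift w∈ =
      shift-intersecting v′∈ w′∈

  weight-movable : ∀ {v} → v ∈ F → Movable v → weight (shift v) < weight v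
  weight-movable {v} v∈F mv@(lower-v , _) = subst (λ w → weight w < weight v) (sym (shift-movable mv))
    (weight-swap p (𝒱.coordinates (All.lookup members v∈F)) lower-v)

  weight-shift : ∀ {v} → v ∈ F → weight (shift v) ≤ weight v
  weight-shift {v} v∈F = by-cases (movable? v)
    where
    by-cases : Dec (Movable v) → weight (shift v) ≤ weight v
    by-cases (yes mv) = <⇒≤ (weight-movable v∈F mv)
    by-cases (no ¬mv) with movable? v
    ... | yes mv = contradiction mv ¬mv
    ... | no _   = ≤-refl

  shift-decreases : ∀ {v} → v ∈ F → Movable v → sum (map weight (map shift F)) < sum (map weight F)
  shift-decreases v∈F mv = subst (_< sum (map weight F)) (cong sum (map-∘ F))
    (sum-map-< weight-shift v∈F (weight-movable v∈F mv))

-- Shift along any `p` that still has a movable member. Each round lowers the total weight strictly,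
-- so `bound` limits the number of rounds.
stabilise : ∀ {n k} {F : List (Vec ℤ (suc n))} bound → sum (map weight F) < bound → IntersectingFamily (suc n) k F →
            ∃[ G ] IntersectingFamily (suc n) k G × length G ≡ length F × Stable G
stabilise {n} {F = F} (suc bound) (s≤s F≤bound) F-family
  with Fin.any? (λ p → Any.any? (Shift.movable? F-family p) F)
... | no stable = F , F-family , refl , λ {v} p v∈F lower → decidable-stable (swap p v ∈ᵛ? F)
        λ sv∉F → stable (p , lose v∈F (lower , sv∉F))
... | yes (p , movable) with v , v∈F , mv ← find movable
                        with G , G-family , |G|≡ , stable ←
                          stabilise bound (<-≤-trans (Shift.shift-decreases F-family p v∈F mv) F≤bound)
                                    (Shift.shifted-family F-family p)
  = G , G-family , trans |G|≡ (length-map (Shift.shift F-family p) F) , stable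

-- Slices by the value of the new coordinate.

slice : ∀ {n} → ℤ → List (Vec ℤ (suc n)) → List (Vec ℤ n)
slice y [] = []
slice y ((x ∷ u) ∷ F) = if does (x ℤ.≟ y) then u ∷ slice y F else slice y F

slice⁻ : ∀ {n} y (F : List (Vec ℤ (suc n))) {u} → u ∈ slice y F → y ∷ u ∈ F
slice⁻ y ((x ∷ u) ∷ F) u∈ with x ℤ.≟ y
slice⁻ y ((x ∷ u) ∷ F) (here refl) | yes refl = here refl
slice⁻ y ((x ∷ u) ∷ F) (there u∈)  | yes refl = there (slice⁻ y F u∈)
slice⁻ y ((x ∷ u) ∷ F) u∈          | no _     = there (slice⁻ y F u∈)

slice-unique : ∀ {n} y {F : List (Vec ℤ (suc n))} → Unique F → Unique (slice y F)
slice-unique y {[]} F! = AllPairs.[]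
slice-unique y {(x ∷ u) ∷ F} (xu≢ AllPairs.∷ F!) with x ℤ.≟ y
... | no _     = slice-unique y F!
... | yes refl = All.tabulate (λ v∈ u≡v → All.lookup xu≢ (slice⁻ y F v∈) (cong (x ∷_) u≡v))
  AllPairs.∷ slice-unique y F!

slice-lengths : ∀ {n} {F : List (Vec ℤ (suc n))} → All (λ v → Vec.head v ∈ entries) F →
                length F ≡ length (slice 0ℤ F) + (length (slice -1ℤ F) + length (slice 1ℤ F))
slice-lengths All.[] = refl
slice-lengths {F = (_ ∷ _) ∷ F} (here refl All.∷ F±) = cong suc (slice-lengths F±)
slice-lengths {F = (_ ∷ _) ∷ F} (there (here refl) All.∷ F±) =
  trans (cong suc (slice-lengths F±)) (sym (trans (cong (length (slice 0ℤ F) +_) (+-suc _ _)) (+-suc _ _)))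
slice-lengths {F = (_ ∷ _) ∷ F} (there (there (here refl)) All.∷ F±) =
  trans (cong suc (slice-lengths F±)) (sym (+-suc _ _))

-- Together with `m-largest` this is all that the argument uses about `m`.
m-attained : ∀ n k → ∃[ F ] IntersectingFamily n k F × length F ≡ m n k
m-attained n k = proj₁ (largestFamily n k) , proj₁ (proj₂ (largestFamily n k)) , refl

m-largest : ∀ {n k G} → IntersectingFamily n k G → length G ≤ m n k
m-largest {n} {k} {G} = proj₂ (proj₂ (largestFamily n k)) G

-- The upper bound.

module _ {n r : ℕ} {F : List (Vec ℤ (suc n))}
         (F-family : IntersectingFamily (suc n) (suc r) F) (stable : Stable F) where

  open IntersectingFamily F-family

  member : ∀ {y u} → u ∈ slice y F → 𝒱 (suc n) (suc r) (y ∷ u)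
  member {y} u∈ = All.lookup members (slice⁻ y F u∈)

  zero-slice-family : IntersectingFamily n (suc r) (slice 0ℤ F)
  zero-slice-family = mkFamily (slice-unique 0ℤ unique) (All.tabulate (drop ∘ member))
    λ u v u∈ v∈ → subst (ℤ._> ℤ.- (ℤ.+ 2)) (ℤ.+-identityˡ ⟨ u , v ⟩)
      (intersecting (0ℤ ∷ u) (0ℤ ∷ v) (slice⁻ 0ℤ F u∈) (slice⁻ 0ℤ F v∈))
    where
    drop : ∀ {u} → 𝒱 (suc n) (suc r) (0ℤ ∷ u) → 𝒱 n (suc r) u
    drop (mk𝒱 (_ VecAll.∷ u±) u₊ u₋) = mk𝒱 u± u₊ u₋

  minus-slice-signed : All (Signed n (suc r) 0) (slice -1ℤ F)
  minus-slice-signed = All.tabulate (drop ∘ member)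
    where
    drop : ∀ {u} → 𝒱 (suc n) (suc r) (-1ℤ ∷ u) → Signed n (suc r) 0 u
    drop (mk𝒱 (_ VecAll.∷ u±) u₊ u₋) = mkSigned u± u₊ (suc-injective u₋)

  plus-slice-signed : All (Signed n r 1) (slice 1ℤ F)
  plus-slice-signed = All.tabulate (drop ∘ member)
    where
    drop : ∀ {u} → 𝒱 (suc n) (suc r) (1ℤ ∷ u) → Signed n r 1 u
    drop (mk𝒱 (_ VecAll.∷ u±) u₊ u₋) = mkSigned u± (suc-injective u₊) u₋

  minus-plus : ∀ {u v} → u ∈ slice -1ℤ F → v ∈ slice 1ℤ F → ⟨ u , v ⟩ ≢ -1ℤ
  minus-plus u∈ v∈ eq = ℤ.<-irrefl refl (subst (λ t → -1ℤ ℤ.+ t ℤ.> ℤ.- (ℤ.+ 2)) eq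
    (intersecting _ _ (slice⁻ -1ℤ F u∈) (slice⁻ 1ℤ F v∈)))

  -- A 0 in the remainder is smaller than the head 1, so stability puts both exchanged vectors into
  -- `F`. Their heads are 0, and their product is that of the updated remainders.
  plus-plus : ∀ {u v p q} → u ∈ slice 1ℤ F → v ∈ slice 1ℤ F → lookup u p ≡ 0ℤ → lookup v q ≡ 0ℤ →
              ⟨ u [ p ]≔ 1ℤ , v [ q ]≔ 1ℤ ⟩ ≢ ℤ.- (ℤ.+ 2)
  plus-plus {u} {v} {p} {q} u∈ v∈ u-p v-q eq = ℤ.<-irrefl refl
    (subst (λ t → 0ℤ ℤ.+ t ℤ.> ℤ.- (ℤ.+ 2)) eq (intersecting _ _ (moved u∈ u-p) (moved v∈ v-q)))
    where
    moved : ∀ {u p} → u ∈ slice 1ℤ F → lookup u p ≡ 0ℤ → 0ℤ ∷ (u [ p ]≔ 1ℤ) ∈ F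
    moved {u} {p} u∈ u-p = subst (λ t → t ∷ (u [ p ]≔ 1ℤ) ∈ F) u-p
      (stable p (slice⁻ 1ℤ F u∈) (subst (ℤ._< 1ℤ) (sym u-p) (ℤ.+<+ (s≤s z≤n))))

  -- The slice with head 0 is itself an intersecting family, and the other two slices are bounded
  -- jointly by averaging.
  stable-bound : ∀ {z} → n ≡ suc r * suc r + z → length F ≤ m n (suc r) + n C suc r
  stable-bound {z} refl = begin
    length F
      ≡⟨ slice-lengths (All.map (λ { {_ ∷ _} (mk𝒱 (x± VecAll.∷ _) _ _) → x± }) members) ⟩
    length (slice 0ℤ F) + (length (slice -1ℤ F) + length (slice 1ℤ F))
      ≤⟨ +-mono-≤ (m-largest zero-slice-family)
           (Averaging.bound r z (slice-unique -1ℤ unique) (slice-unique 1ℤ unique)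
             minus-slice-signed plus-slice-signed minus-plus plus-plus) ⟩
    m n (suc r) + n C suc r ∎
    where open ≤-Reasoning

m-step-≤ : ∀ {n r z} → n ≡ suc r * suc r + z → m (suc n) (suc r) ≤ m n (suc r) + n C suc r
m-step-≤ {n} {r} n≡
  with F , F-family , |F|≡m ← m-attained (suc n) (suc r)
  with G , G-family , |G|≡|F| , stable ← stabilise (suc (sum (map weight F))) ≤-refl F-family =
  subst (_≤ m n (suc r) + n C suc r) (trans |G|≡|F| |F|≡m) (stable-bound G-family stable n≡)

-- The lower bound.

subsets : ∀ n → ℕ → List (Vec ℤ n)
subsets zero    zero    = [ [] ]
subsets zero    (suc k) = []
subsets (suc n) zero    = map (0ℤ ∷_) (subsets n zero)
subsets (suc n) (suc k) = map (1ℤ ∷_) (subsets n k) ++ map (0ℤ ∷_) (subsets n (suc k))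

length-subsets : ∀ n k → length (subsets n k) ≡ n C k
length-subsets zero    zero    = refl
length-subsets zero    (suc k) = refl
length-subsets (suc n) zero    = trans (length-map (0ℤ ∷_) (subsets n zero)) (length-subsets n zero)
length-subsets (suc n) (suc k) = begin
  length (map (1ℤ ∷_) (subsets n k) ++ map (0ℤ ∷_) (subsets n (suc k)))
    ≡⟨ length-++ (map (1ℤ ∷_) (subsets n k)) ⟩
  length (map (1ℤ ∷_) (subsets n k)) + length (map (0ℤ ∷_) (subsets n (suc k)))
    ≡⟨ cong₂ _+_ (trans (length-map (1ℤ ∷_) (subsets n k)) (length-subsets n k))
                 (trans (length-map (0ℤ ∷_) (subsets n (suc k))) (length-subsets n (suc k))) ⟩
  n C k + n C suc k
    ≡⟨ nCk+nC[k+1]≡[n+1]C[k+1] n k ⟩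
  suc n C suc k ∎
  where open ≡-Reasoning

map-∷-disjoint : ∀ {n} {x y : ℤ} {F G : List (Vec ℤ n)} → x ≢ y → ∀ {v} → ¬ (v ∈ map (x ∷_) F × v ∈ map (y ∷_) G)
map-∷-disjoint {x = x} {y} x≢y (v∈F , v∈G)
  with _ , _ , refl ← ∈-map⁻ (x ∷_) v∈F | _ , _ , eq ← ∈-map⁻ (y ∷_) v∈G = x≢y (∷-injectiveˡ eq)

subsets-unique : ∀ n k → Unique (subsets n k)
subsets-unique zero    zero    = All.[] AllPairs.∷ AllPairs.[]
subsets-unique zero    (suc k) = AllPairs.[]
subsets-unique (suc n) zero    = Unique.map⁺ ∷-injectiveʳ (subsets-unique n zero)
subsets-unique (suc n) (suc k) = Unique.++⁺ (Unique.map⁺ ∷-injectiveʳ (subsets-unique n k))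
  (Unique.map⁺ ∷-injectiveʳ (subsets-unique n (suc k))) (map-∷-disjoint λ ())

subsets-signed : ∀ n k → All (Signed n k 0) (subsets n k)
subsets-signed zero    zero    = mkSigned VecAll.[] refl refl All.∷ All.[]
subsets-signed zero    (suc k) = All.[]
subsets-signed (suc n) zero    = All.map⁺ (All.map
  (λ (mkSigned v± v₊ v₋) → mkSigned (here refl VecAll.∷ v±) v₊ v₋) (subsets-signed n zero))
subsets-signed (suc n) (suc k) = All.++⁺
  (All.map⁺ (All.map (λ (mkSigned v± v₊ v₋) → mkSigned (there (here refl) VecAll.∷ v±) (cong suc v₊) v₋)
    (subsets-signed n k)))
  (All.map⁺ (All.map (λ (mkSigned v± v₊ v₋) → mkSigned (here refl VecAll.∷ v±) v₊ v₋) (subsets-signed n (suc k))))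

-- Since `u` has no -1, a coordinate contributes a negative term only where `v` is -1, and that term
-- is at least -1.
⟨⟩-lower : ∀ {n a b c} {u v : Vec ℤ n} → Signed n a 0 u → Signed n b c v → ℤ.- (ℤ.+ c) ℤ.≤ ⟨ u , v ⟩
⟨⟩-lower (mkSigned u± _ u₋) (mkSigned v± _ refl) = lower u± u₋ v±
  where
  entrywise : ∀ {x y} → x ∈ entries → x ≢ -1ℤ → y ∈ entries → ℤ.- (ℤ.+ ⟦ y ℤ.≟ -1ℤ ⟧) ℤ.≤ x ℤ.* y
  entrywise (here refl)                 _     (here refl)                 = ℤ.+≤+ z≤n
  entrywise (here refl)                 _     (there (here refl))         = ℤ.+≤+ z≤n
  entrywise (here refl)                 _     (there (there (here refl))) = ℤ.-≤+
  entrywise (there (here refl))         _     (here refl)                 = ℤ.+≤+ z≤n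
  entrywise (there (here refl))         _     (there (here refl))         = ℤ.+≤+ z≤n
  entrywise (there (here refl))         _     (there (there (here refl))) = ℤ.-≤- z≤n
  entrywise (there (there (here refl))) x≢-1  _                           = contradiction refl x≢-1
  lower : ∀ {n} {u v : Vec ℤ n} → VecAll.All (_∈ entries) u → count (ℤ._≟ -1ℤ) u ≡ 0 → VecAll.All (_∈ entries) v →
          ℤ.- (ℤ.+ count (ℤ._≟ -1ℤ) v) ℤ.≤ ⟨ u , v ⟩
  lower VecAll.[] _ VecAll.[] = ℤ.≤-refl
  lower {u = x ∷ u} {y ∷ v} (x± VecAll.∷ u±) u₋ (y± VecAll.∷ v±) = begin
    ℤ.- (ℤ.+ count (ℤ._≟ -1ℤ) (y ∷ v))
      ≡⟨ cong (λ t → ℤ.- (ℤ.+ t)) (count-∷ (ℤ._≟ -1ℤ) y v) ⟩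
    ℤ.- (ℤ.+ ⟦ y ℤ.≟ -1ℤ ⟧ ℤ.+ ℤ.+ count (ℤ._≟ -1ℤ) v)
      ≡⟨ ℤ.neg-distrib-+ (ℤ.+ ⟦ y ℤ.≟ -1ℤ ⟧) (ℤ.+ count (ℤ._≟ -1ℤ) v) ⟩
    ℤ.- (ℤ.+ ⟦ y ℤ.≟ -1ℤ ⟧) ℤ.+ ℤ.- (ℤ.+ count (ℤ._≟ -1ℤ) v)
      ≤⟨ ℤ.+-mono-≤ (entrywise x± x≢-1 y±) (lower u± (m+n≡0⇒n≡0 ⟦ x ℤ.≟ -1ℤ ⟧ x+u₋) v±) ⟩
    ⟨ x ∷ u , y ∷ v ⟩ ∎
    where
    open ℤ.≤-Reasoning
    x+u₋ : ⟦ x ℤ.≟ -1ℤ ⟧ + count (ℤ._≟ -1ℤ) u ≡ 0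
    x+u₋ = trans (sym (count-∷ (ℤ._≟ -1ℤ) x u)) u₋
    x≢-1 : x ≢ -1ℤ
    x≢-1 refl = contradiction u₋ λ ()

module Extension {n k : ℕ} {F : List (Vec ℤ n)} (F-family : IntersectingFamily n k F) where

  open IntersectingFamily F-family

  extension : List (Vec ℤ (suc n))
  extension = map (0ℤ ∷_) F ++ map (-1ℤ ∷_) (subsets n k)

  length-extension : length extension ≡ length F + n C k
  length-extension = trans (length-++ (map (0ℤ ∷_) F))
    (cong₂ _+_ (length-map (0ℤ ∷_) F) (trans (length-map (-1ℤ ∷_) (subsets n k)) (length-subsets n k)))

  subset-signed : ∀ {u} → u ∈ subsets n k → Signed n k 0 u
  subset-signed = All.lookup (subsets-signed n k)

  subset-product : ∀ {u v} → u ∈ subsets n k → v ∈ F → ⟨ u , v ⟩ ℤ.> ℤ.- (ℤ.+ 2)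
  subset-product u∈ v∈ with mk𝒱 v± v₊ v₋ ← All.lookup members v∈ =
    ℤ.<-≤-trans (ℤ.-<- (s≤s z≤n)) (⟨⟩-lower (subset-signed u∈) (mkSigned v± v₊ v₋))

  -- An old and a new vector have head product 0, and the single -1 of the old one keeps the rest at
  -- least -1. Two new vectors have head product 1, and their remainders have no negative entries.
  extension-intersecting : Intersecting extension
  extension-intersecting _ _ v∈ w∈ with ∈-++⁻ (map (0ℤ ∷_) F) v∈ | ∈-++⁻ (map (0ℤ ∷_) F) w∈
  ... | inj₁ v∈₀ | inj₁ w∈₀ with v , v∈F , refl ← ∈-map⁻ (0ℤ ∷_) v∈₀ | w , w∈F , refl ← ∈-map⁻ (0ℤ ∷_) w∈₀ =
    subst (ℤ._> ℤ.- (ℤ.+ 2)) (sym (ℤ.+-identityˡ ⟨ v , w ⟩)) (intersecting v w v∈F w∈F)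
  ... | inj₁ v∈₀ | inj₂ w∈₋ with v , v∈F , refl ← ∈-map⁻ (0ℤ ∷_) v∈₀ | w , w∈S , refl ← ∈-map⁻ (-1ℤ ∷_) w∈₋ =
    subst (ℤ._> ℤ.- (ℤ.+ 2)) (sym (trans (ℤ.+-identityˡ ⟨ v , w ⟩) (⟨⟩-comm v w))) (subset-product w∈S v∈F)
  ... | inj₂ v∈₋ | inj₁ w∈₀ with v , v∈S , refl ← ∈-map⁻ (-1ℤ ∷_) v∈₋ | w , w∈F , refl ← ∈-map⁻ (0ℤ ∷_) w∈₀ =
    subst (ℤ._> ℤ.- (ℤ.+ 2)) (sym (ℤ.+-identityˡ ⟨ v , w ⟩)) (subset-product v∈S w∈F)
  ... | inj₂ v∈₋ | inj₂ w∈₋ with v , v∈S , refl ← ∈-map⁻ (-1ℤ ∷_) v∈₋ | w , w∈S , refl ← ∈-map⁻ (-1ℤ ∷_) w∈₋ =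
    ℤ.<-≤-trans ℤ.-<+ (ℤ.+-monoʳ-≤ 1ℤ (⟨⟩-lower (subset-signed v∈S) (subset-signed w∈S)))

  extension-family : IntersectingFamily (suc n) k extension
  extension-family = mkFamily
    (Unique.++⁺ (Unique.map⁺ ∷-injectiveʳ unique) (Unique.map⁺ ∷-injectiveʳ (subsets-unique n k))
      (map-∷-disjoint λ ()))
    (All.++⁺ (All.map⁺ (All.map (λ (mk𝒱 v± v₊ v₋) → mk𝒱 (here refl VecAll.∷ v±) v₊ v₋) members))
             (All.map⁺ (All.map (λ (mkSigned v± v₊ v₋) → mk𝒱 (there (there (here refl)) VecAll.∷ v±) v₊ (cong suc v₋))
                         (subsets-signed n k))))
    extension-intersecting

m-step-≥ : ∀ n k → m n k + n C k ≤ m (suc n) k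
m-step-≥ n k with F , F-family , |F|≡m ← m-attained n k = subst (λ t → t + n C k ≤ m (suc n) k) |F|≡m
  (subst (_≤ m (suc n) k) (Extension.length-extension F-family) (m-largest (Extension.extension-family F-family)))

-- Iterating the one-step recurrence.

m-recurrence : ∀ k d → 2 ≤ k → m (k ^ 2 + d) k ≡ m (k ^ 2) k + sum (map (λ i → (k ^ 2 + i) C k) (upTo d))
m-recurrence k zero    2≤k = trans (cong (λ n → m n k) (+-identityʳ (k ^ 2))) (sym (+-identityʳ _))
m-recurrence zero (suc d) ()
m-recurrence k@(suc r) (suc d) 2≤k = begin
  m (k ^ 2 + suc d) k
    ≡⟨ cong (λ n → m n k) (+-suc (k ^ 2) d) ⟩
  m (suc (k ^ 2 + d)) k
    -- Here `d` coordinates are left over after the grid. As `k ^ 2` unfolds to `k * (k * 1)`, the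
    -- inner unit is removed to match the shape `k * k + d`.
    ≡⟨ ≤-antisym (m-step-≤ (cong (λ t → k * t + d) (*-identityʳ k))) (m-step-≥ (k ^ 2 + d) k) ⟩
  m (k ^ 2 + d) k + f d
    ≡⟨ cong (_+ f d) (m-recurrence k d 2≤k) ⟩
  m (k ^ 2) k + sum (map f (upTo d)) + f d
    ≡⟨ +-assoc (m (k ^ 2) k) (sum (map f (upTo d))) (f d) ⟩
  m (k ^ 2) k + (sum (map f (upTo d)) + f d)
    ≡⟨ cong (m (k ^ 2) k +_) last-summand ⟨
  m (k ^ 2) k + sum (map f (upTo (suc d))) ∎
  where
  open ≡-Reasoning
  f : ℕ → ℕ
  f i = (k ^ 2 + i) C k
  -- `upTo (suc d)` ends with `d`, so the summand split off at the right end is the one added by the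
  -- last step.
  last-summand : sum (map f (upTo (suc d))) ≡ sum (map f (upTo d)) + f d
  last-summand = begin
    sum (map f (upTo (suc d)))               ≡⟨ cong (sum ∘ map f) (upTo-∷ʳ d) ⟨
    sum (map f (upTo d ++ [ d ]))            ≡⟨ cong sum (map-++ f (upTo d) [ d ]) ⟩
    sum (map f (upTo d) ++ [ f d ])          ≡⟨ sum-++ (map f (upTo d)) [ f d ] ⟩
    sum (map f (upTo d)) + (f d + 0)         ≡⟨ cong (sum (map f (upTo d)) +_) (+-identityʳ (f d)) ⟩
    sum (map f (upTo d)) + f d               ∎

corollary4 : (k n : ℕ) → 2 ≤ k → k ^ 2 < n →
    m n k ≡ m (k ^ 2) k + sum (map (λ i → (k ^ 2 + i) C k) (upTo (n ∸ k ^ 2)))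
corollary4 k n 2≤k k²<n = trans (cong (λ n → m n k) (sym (m+[n∸m]≡n (<⇒≤ k²<n)))) (m-recurrence k (n ∸ k ^ 2) 2≤k)
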